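{- Let $T=(X,Y,S,\mathcal{D}_X)$ be a task. For any finite $X_n\subseteq X$ and any $\theta\in(0,1]$ such that there exists an AOTM $\mathcal{M}$ for $T$ achieving expected quality at least $\theta$ on $X_n$, i.e. $\mathbb{E}_{x\sim\mathcal{D}_X|_{X_n}}[S(x,\mathcal{M}(x))]\ge\theta$, the complexity frontier $F_T(\theta;X_n)\subseteq\mathbb{R}^3$ is non-empty.
   Context: Fix a finite alphabet $\Sigma$. A task is a tuple $T=(X,Y,S,\mathcal{D}_X)$ where $X\subseteq\Sigma^*$ is the input space, $Y\subseteq\Sigma^*$ the output space, $S:X\times Y\to[0,1]$ a score function, and $\mathcal{D}_X$ a probability distribution on $X$. For $X_n\subseteq X$, $\mathcal{D}_X|_{X_n}$ denotes $\mathcal{D}_X$ conditioned on $X_n$. A stochastic oracle is a family $\mathcal{O}=\{\mathcal{D}_q: q\in\Sigma^*\}$, where $\mathcal{D}_q$ is a probability distribution on responses in $\Sigma^*$. An AI-Oracle Turing Machine (AOTM) is a pair $\mathcal{M}=(M,\mathcal{O})$, where $\mathcal{O}$ is a stochastic oracle and $M$ is a multi-tape probabilistic Turing machine with an input tape, an output tape, one or more work tapes, a read-only random tape containing an infinite sequence of uniformly random bits, a query tape and a response tape. On each oracle call $M$ writes a query $q\in\Sigma^*$ on the query tape, the oracle draws a response $r\in\Sigma^*$ from $\mathcal{D}_q$ and writes it on the response tape, and $M$ continues its computation; a call counts as one step of $M$. For an AOTM for $T$, $\mathcal{M}(x)\in Y$ denotes the (random) final output on input $x\in X$. Fix a tokenizer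 $\tau:\Sigma^*\to\mathcal{T}^*$, a map from strings to finite token sequences having a decoder $\rho:\mathcal{T}^*\to\Sigma^*$ with $\rho(\tau(s))=s$ for all $s$. If $(q_i,r_i)$ are the query and response of the $i$-th oracle call of $\mathcal{M}$ on $x$, let $\mathrm{tok}_{\mathcal{M}}(x)=\sum_i|\tau(q_i)|+\sum_i|\tau(r_i)|$, where $|\cdot|$ is the number of tokens. $\mathrm{TIME}_{\mathcal{M}}(x)$ is the number of transitions of $M$ on $x$ (each oracle call counted as a single step), and $\mathrm{SPACE}_{\mathcal{M}}(x)$ is the amount of tape $M$ uses on $x$, in the standard sense, measured worst-case. Expectations are taken jointly over $x$, the random tape of $M$, and the oracle responses. The complexity frontier of $T$ at threshold $\theta\in(0,1]$ over $X_n\subseteq X$ is the set $F_T(\theta;X_n)$ of all $(k,t,s)\in\mathbb{R}^3$ for which there exists an AOTM $\mathcal{M}=(M,\mathcal{O})$ for $T$ such that $\mathbb{E}_{x\sim\mathcal{D}_X|_{X_n}}[\mathrm{tok}_{\mathcal{M}}(x)]\le k$, $\mathbb{E}_{x\sim\mathcal{D}_X|_{X_n}}[\mathrm{TIME}_{\mathcal{M}}(x)]\le t$, $\max_{x\in X_n}\mathrm{SPACE}_{\mathcal{M}}(x)\le s$, and $\mathbb{E}_{x\sim\mathcal{D}_X|_{X_n}}[S(x,\mathcal{M}(x))]\ge\theta$. -}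

module Defs where

open import Level using (0ℓ) renaming (suc to lsuc)
open import Data.Bool.Base using (Bool; true; false; if_then_else_)
open import Data.Nat.Base as ℕ using (ℕ; zero; suc; _⊔_)
open import Data.Nat.ListAction using (sum)
open import Data.Integer.Base using (+_)
open import Data.Rational.Base as ℚ using (ℚ; 0ℚ; 1ℚ; ½)
open import Data.Rational.Properties using (<-dense; <-trans)
open import Data.Fin.Base using (Fin; zero; suc)
import Data.Fin.Properties as Fin
open import Data.List.Base using (List; []; _∷_; length; map; foldr; drop; reverse; _++_)
open import Data.List.Membership.Propositional using () renaming (_∈_ to _∈ˡ_)
open import Data.List.Relation.Unary.Unique.Propositional using (Unique)
open import Data.Vec.Base as Vec using (Vec; _∷_; lookup; replicate; zipWith; _[_]≔_)
open import Data.Product.Base using (Σ-syntax; ∃-syntax; _×_; _,_)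
open import Data.Sum.Base using (_⊎_)
open import Relation.Binary.PropositionalEquality using (_≡_)
open import Relation.Nullary using (¬_)
open import Relation.Nullary.Decidable using (Dec; yes; no; does)
open import Relation.Unary using (Pred)

private
  variable
    σ : ℕ

------------------------------------------------------------------------
-- Real numbers

-- Textbook (lower) Dedekind cuts, to be used under excluded middle.
-- A cut a represents the supremum of { q ∣ a ∋ q }; since neither
-- inhabitation nor properness is required, -∞ (no q) and +∞ (every q)
-- are included.

record ℝ∞ : Set₁ where
  infix 4 _∋_
  field
    _∋_     : ℚ → Set
    down    : ∀ {p q} → p ℚ.< q → _∋_ q → _∋_ p
    rounded : ∀ {p} → _∋_ p → ∃[ q ] (p ℚ.< q × _∋_ q)

open ℝ∞ public using (_∋_)

record ℝ : Set₁ where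
  field
    ext   : ℝ∞
    >-∞   : ∃[ q ] ext ∋ q
    <+∞   : ∃[ q ] ¬ (ext ∋ q)

open ℝ public using (ext)

infix 4 _≤_ _≈_ _<_

_≤_ : ℝ∞ → ℝ∞ → Set
a ≤ b = ∀ q → a ∋ q → b ∋ q

_≈_ : ℝ∞ → ℝ∞ → Set
a ≈ b = a ≤ b × b ≤ a

_<_ : ℝ∞ → ℝ∞ → Set
a < b = ∃[ q ] (b ∋ q × ¬ (a ∋ q))

-- The supremum of a set of rationals.
supℚ : (ℚ → Set) → ℝ∞
supℚ P = record
  { _∋_     = λ p → ∃[ q ] (p ℚ.< q × P q)
  ; down    = λ p<q (r , q<r , Pr) → r , <-trans p<q q<r , Pr
  ; rounded = λ (r , p<r , Pr) → let (m , p<m , m<r) = <-dense p<r in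
                m , p<m , r , m<r , Pr
  }

sup : {I : Set} → (I → ℝ∞) → ℝ∞
sup f = supℚ λ q → ∃[ i ] f i ∋ q

fromℚ : ℚ → ℝ∞
fromℚ p = supℚ (p ≡_)

fromℕ : ℕ → ℝ∞
fromℕ n = fromℚ (+ n ℚ./ 1)

0∞ 1∞ : ℝ∞
0∞ = fromℚ 0ℚ
1∞ = fromℚ 1ℚ

infixl 6 _+_
infixl 7 _·_ _÷_

_+_ : ℝ∞ → ℝ∞ → ℝ∞
a + b = supℚ λ q → ∃[ u ] ∃[ v ] (a ∋ u × b ∋ v × q ≡ u ℚ.+ v)

-- Product and quotient are only meant for arguments in [0,∞]; there
-- 0 · ∞ = 0 and 0 ÷ 0 = 0.  Under excluded middle ¬ (b ∋ r) says b ≤ r.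

_·_ : ℝ∞ → ℝ∞ → ℝ∞
a · b = supℚ λ q → q ≡ 0ℚ ⊎
  (∃[ u ] ∃[ v ] (0ℚ ℚ.≤ u × 0ℚ ℚ.≤ v × a ∋ u × b ∋ v × q ≡ u ℚ.* v))

_÷_ : ℝ∞ → ℝ∞ → ℝ∞
a ÷ b = supℚ λ q → q ≡ 0ℚ ⊎ (∃[ r ] (¬ (b ∋ r) × a ∋ q ℚ.* r))

∑ : {A : Set} → List A → (A → ℝ∞) → ℝ∞
∑ xs f = foldr (λ x acc → f x + acc) 0∞ xs

-- Unordered sum of a [0,∞]-valued family: the supremum of its sums over
-- finite subsets of the index set.
∑∞ : {A : Set} → (A → ℝ∞) → ℝ∞
∑∞ {A} f = sup {∃[ xs ] Unique {A = A} xs} λ (xs , _) → ∑ xs f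

------------------------------------------------------------------------
-- Strings, distributions, tasks, tokenizers

Str : ℕ → Set
Str σ = List (Fin σ)

-- Σ* is countable, so a probability distribution on it is a mass function.
record Distribution (σ : ℕ) : Set₁ where
  field
    mass        : Str σ → ℝ
    nonNegative : ∀ s → 0∞ ≤ ext (mass s)
    total       : ∑∞ (λ s → ext (mass s)) ≈ 1∞

  Pr : Str σ → ℝ∞
  Pr s = ext (mass s)

open Distribution public using (Pr)

-- The score is extended arbitrarily outside X × Y.
record Task (σ : ℕ) : Set₁ where
  field
    X Y       : Pred (Str σ) 0ℓ
    score     : Str σ → Str σ → ℝ
    score-0≤  : ∀ {x y} → X x → Y y → 0∞ ≤ ext (score x y)
    score-≤1  : ∀ {x y} → X x → Y y → ext (score x y) ≤ 1∞
    𝒟         : Distribution σ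
    supported : ∀ {x} → 0∞ < Pr 𝒟 x → X x

record Tokenizer (σ : ℕ) (𝒯 : Set) : Set where
  field
    τ       : Str σ → List 𝒯
    ρ       : List 𝒯 → Str σ
    ρ-left  : ∀ s → ρ (τ s) ≡ s

------------------------------------------------------------------------
-- Tapes

data Symbol (σ aux : ℕ) : Set where
  blank  : Symbol σ aux
  letter : Fin σ → Symbol σ aux
  extra  : Fin aux → Symbol σ aux

data Move : Set where
  L R S : Move

module _ {σ aux : ℕ} where

  -- A one-way infinite tape.  ‘left’ holds the cells to the left of the
  -- head, nearest first; ‘right’ holds the scanned cell and the cells to
  -- its right, followed by blanks; ‘scanned’ is the number of cells the
  -- head has visited so far.
  record Tape : Set where
    constructor tape
    field
      left    : List (Symbol σ aux)
      right   : List (Symbol σ aux)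
      scanned : ℕ

  open Tape public

  fresh : Str σ → Tape
  fresh s = tape [] (map letter s) 1

  read : Tape → Symbol σ aux
  read (tape _ []      _) = blank
  read (tape _ (a ∷ _) _) = a

  write : Symbol σ aux → Tape → Tape
  write a (tape l r n) = tape l (a ∷ drop 1 r) n

  -- A left move at the leftmost cell has no effect.
  shift : Move → Tape → Tape
  shift S t                  = t
  shift L (tape []      r n) = tape [] r n
  shift L (tape (a ∷ l) r n) = tape l (a ∷ r) n
  shift R t@(tape l r n)     = tape (read t ∷ l) (drop 1 r) (n ⊔ (2 ℕ.+ length l))

  perform : Symbol σ aux × Move → Tape → Tape
  perform (a , m) t = shift m (write a t)

  letters : List (Symbol σ aux) → Str σ
  letters (letter a ∷ s) = a ∷ letters s
  letters _              = []

  -- The string on a tape: the letters from the leftmost cell up to the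
  -- first cell not holding a letter of Σ.
  contents : Tape → Str σ
  contents t = letters (reverse (left t) ++ right t)

  -- The oracle replaces the contents and returns the head to the leftmost
  -- cell.
  respond : Str σ → Tape → Tape
  respond s t = tape [] (map letter s) (scanned t)

shiftℕ : Move → ℕ → ℕ
shiftℕ L n = ℕ.pred n
shiftℕ S n = n
shiftℕ R n = suc n

------------------------------------------------------------------------
-- Machines

-- The read-write tapes are input, output, query, response and
-- 1 + extraWork work tapes; the random tape is kept separately.

input output query response : ∀ {w} → Fin (5 ℕ.+ w)
input    = zero
output   = suc zero
query    = suc (suc zero)
response = suc (suc (suc zero))

data Action (states tapes σ aux : ℕ) : Set where
  go   : Fin states → Vec (Symbol σ aux × Move) tapes → Move →
         Action states tapes σ aux
  call : Fin states → Action states tapes σ aux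

record Machine (σ : ℕ) : Set where
  field
    states aux extraWork : ℕ
    start halt           : Fin states

  tapes : ℕ
  tapes = 5 ℕ.+ extraWork

  -- The arguments are the current state, the scanned symbols, and the
  -- scanned random bit; the last component of ‘go’ moves the random head.
  field
    δ : Fin states → Vec (Symbol σ aux) tapes → Bool →
        Action states tapes σ aux

RandomTape : Set
RandomTape = ℕ → Bool

-- Outcome of one transition: none (halted), an ordinary move, or an
-- oracle call whose successor depends on the response.
data Step (A : Set) (σ : ℕ) : Set where
  halted : Step A σ
  next   : A → Step A σ
  ask    : Str σ → (Str σ → A) → Step A σ

module Run (M : Machine σ) where
  open Machine M

  -- ‘calls’ logs the queries and responses, latest first.
  record Config : Set where
    constructor config
    field
      state      : Fin states
      tapeVec    : Vec (Tape {σ} {aux}) tapes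
      randomHead : ℕ
      time       : ℕ
      calls      : List (Str σ × Str σ)

  open Config public

  initial : Str σ → Config
  initial x = config start (replicate tapes (fresh []) [ input ]≔ fresh x) 0 0 []

  isHalted : (c : Config) → Dec (state c ≡ halt)
  isHalted c = state c Fin.≟ halt

  result : Config → Str σ
  result c = contents (lookup (tapeVec c) output)

  -- Number of cells scanned on all tapes other than the random tape.
  space : Config → ℕ
  space c = Vec.sum (Vec.map scanned (tapeVec c))

  step : RandomTape → Config → Step Config σ
  step ω c@(config s ts h t qs) with isHalted c
  ... | yes _ = halted
  ... | no  _ with δ s (Vec.map read ts) (ω h)
  ...   | go s′ acts m =
            next (config s′ (zipWith perform acts ts) (shiftℕ m h) (suc t) qs)
  ...   | call s′ =
            let q = contents (lookup ts query) in
            ask q λ r → config s′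
              (ts [ response ]≔ respond r (lookup ts response))
              h (suc t) ((q , r) ∷ qs)

Oracle : ℕ → Set₁
Oracle σ = Str σ → Distribution σ

record AOTM (σ : ℕ) : Set₁ where
  field
    machine : Machine σ
    oracle  : Oracle σ

cons : Bool → RandomTape → RandomTape
cons b ω zero    = b
cons b ω (suc i) = ω i

-- Expectation of g over a uniform random tape, for g depending only on the
-- first n bits.
mean : ℕ → (RandomTape → ℝ∞) → ℝ∞
mean zero    g = g (λ _ → false)
mean (suc n) g = fromℚ ½ · mean n (λ ω → g (cons false ω))
               + fromℚ ½ · mean n (λ ω → g (cons true  ω))

module Semantics (𝓜 : AOTM σ) where
  open AOTM 𝓜 public
  open Run machine public

  -- Configurations that can occur on input x with random tape ω; an oracle
  -- response can occur if it has positive probability.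
  data Reachable (x : Str σ) (ω : RandomTape) : Config → Set where
    begin : Reachable x ω (initial x)
    move  : ∀ {c c′} → Reachable x ω c → step ω c ≡ next c′ →
            Reachable x ω c′
    reply : ∀ {c q k} r → Reachable x ω c → step ω c ≡ ask q k →
            0∞ < Pr (oracle q) r → Reachable x ω (k r)

  -- Expectation, over the oracle responses, of f at the configuration n
  -- steps after c (or at the halting configuration, if that comes first).
  after : ℕ → RandomTape → Config → (Config → ℝ∞) → ℝ∞
  after zero    ω c f = f c
  after (suc n) ω c f with step ω c
  ... | halted  = f c
  ... | next c′ = after n ω c′ f
  ... | ask q k = ∑∞ λ r → Pr (oracle q) r · after n ω (k r) f

  -- Expectation, over the random tape and the oracle responses, of the limit
  -- of f along the run on x, for f ≥ 0 non-decreasing along every run: by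
  -- monotone convergence it is the supremum of the expectations at step n.
  -- The first n steps read only the first n random bits.
  𝔼run : Str σ → (Config → ℝ∞) → ℝ∞
  𝔼run x f = sup λ n → mean n λ ω → after n ω (initial x) f

  onHalt : (Str σ → ℝ∞) → Config → ℝ∞
  onHalt g c = if does (isHalted c) then g (result c) else 0∞

  𝔼TIME : Str σ → ℝ∞
  𝔼TIME x = 𝔼run x λ c → fromℕ (time c)

  𝔼tok : {𝒯 : Set} → Tokenizer σ 𝒯 → Str σ → ℝ∞
  𝔼tok tk x = 𝔼run x λ c →
    fromℕ (sum (map (λ (q , r) → length (τ q) ℕ.+ length (τ r)) (calls c)))
    where open Tokenizer tk

  𝔼output : Str σ → (Str σ → ℝ∞) → ℝ∞
  𝔼output x g = 𝔼run x (onHalt g)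

  SPACE : Str σ → ℝ∞
  SPACE x = sup {Σ[ ω ∈ RandomTape ] ∃[ c ] Reachable x ω c}
              λ (_ , c , _) → fromℕ (space c)

open Semantics using (𝔼TIME; 𝔼tok; 𝔼output; SPACE)

-- On every x ∈ X the machine halts almost surely, with an output in Y.
record _For_ (𝓜 : AOTM σ) (T : Task σ) : Set where
  open Task T
  open Semantics 𝓜 hiding (𝔼TIME; 𝔼tok; 𝔼output; SPACE)
  field
    halts    : ∀ {x} → X x → 𝔼output 𝓜 x (λ _ → 1∞) ≈ 1∞
    output-Y : ∀ {x ω c} → X x → Reachable x ω c → state c ≡ Machine.halt machine →
               Y (result c)

------------------------------------------------------------------------
-- Complexity frontier

-- Expectation of f under 𝒟 conditioned on the finite set listed, without
-- repetition, by Xₙ.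
𝔼∣ : Distribution σ → List (Str σ) → (Str σ → ℝ∞) → ℝ∞
𝔼∣ 𝒟 Xₙ f = ∑ Xₙ λ x → Pr 𝒟 x ÷ ∑ Xₙ (Pr 𝒟) · f x

maxOver : List (Str σ) → (Str σ → ℝ∞) → ℝ∞
maxOver Xₙ f = sup {∃[ x ] x ∈ˡ Xₙ} λ (x , _) → f x

quality : Task σ → List (Str σ) → AOTM σ → ℝ∞
quality T Xₙ 𝓜 = 𝔼∣ 𝒟 Xₙ λ x → 𝔼output 𝓜 x λ y → ext (score x y)
  where open Task T

Frontier : {𝒯 : Set} → Tokenizer σ 𝒯 → Task σ → ℝ → List (Str σ) →
           Pred (ℝ × ℝ × ℝ) (lsuc 0ℓ)
Frontier tk T θ Xₙ (k , t , s) = ∃[ 𝓜 ]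
  ( 𝓜 For T
  × 𝔼∣ 𝒟 Xₙ (𝔼tok 𝓜 tk) ≤ ext k
  × 𝔼∣ 𝒟 Xₙ (𝔼TIME 𝓜) ≤ ext t
  × maxOver Xₙ (SPACE 𝓜) ≤ ext s
  × ext θ ≤ quality T Xₙ 𝓜 )
  where open Task T using (𝒟)

{-# OPTIONS --safe #-}
module Submission where

-- The given machine may have infinite expected cost, so it has to be replaced.
-- On each x ∈ X some y ∈ Y satisfies E[S(x, M(x))] ≤ S(x, y): if every possible
-- output scored strictly less than e = E[S(x, M(x))], then at any time n the runs
-- already halted would score below e and the others end up with at most e, so
-- expectation e forces the probability of having halted by time n to be 0,
-- against almost sure halting.  Choosing such a y(x), let the oracle answer x
-- with y(x), deterministically, and let the machine copy its input to the query
-- tape and the response to the output tape.  On each input its cost is bounded,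
-- hence so are the averages and the maximum over the finite set Xₙ.

open import Level using (0ℓ)
open import Axiom.ExcludedMiddle using (ExcludedMiddle)
open import Data.Bool.Base using (Bool; true; false; if_then_else_)
open import Data.Empty using (⊥-elim)
open import Data.Nat.Base as ℕ using (ℕ; zero; suc)
open import Data.Nat.ListAction using (sum)
import Data.Nat.Properties as ℕ
import Data.Integer.Base as ℤ
open import Data.Integer.Base using (+_; -[1+_])
import Data.Integer.Properties as ℤ
open import Data.Rational.Base as ℚ using (ℚ; 0ℚ; 1ℚ; ½; mkℚ)
import Data.Rational.Properties as ℚ
import Data.Rational.Unnormalised.Base as ℚᵘ
import Data.Rational.Unnormalised.Properties as ℚᵘ
open import Data.Rational.Solver using (module +-*-Solver)
import Data.Fin.Properties as Fin
open import Data.Fin.Base using (Fin; zero; suc)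
open import Data.List.Base using (List; []; _∷_; _++_; _ʳ++_; drop; filter; length; map; reverse)
open import Data.List.Membership.Propositional using () renaming (_∈_ to _∈ˡ_)
open import Data.List.Properties as List using (filter-all)
open import Data.List.Relation.Unary.All as All using (All; []; _∷_)
open import Data.List.Relation.Unary.All.Properties using (all-filter)
open import Data.List.Relation.Unary.Any using (here; there)
open import Data.List.Relation.Unary.AllPairs using ([]; _∷_)
open import Data.List.Relation.Unary.Unique.Propositional using (Unique)
open import Data.List.Relation.Unary.Unique.Propositional.Properties using (filter⁺)
open import Data.Vec.Base as Vec using ([]; _∷_)
import Data.Vec.Relation.Unary.All as VecAll
open VecAll using ([]; _∷_)
open import Data.Product.Base using (∃-syntax; _×_; _,_; proj₁; proj₂)
open import Data.Sum.Base using (_⊎_; inj₁; inj₂)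
open import Function.Base using (_∘_)
open import Relation.Binary.Definitions using (tri<; tri≈; tri>)
open import Relation.Binary.PropositionalEquality
open import Relation.Nullary using (¬_; Dec; yes; no; contradiction)
open import Relation.Nullary.Decidable using (does; dec-true; ¬?)
open import Relation.Unary using (Satisfiable)
open import Defs
open import Algebra.Properties.Group ℚ.+-0-group using (//-rightDividesˡ; //-rightDividesʳ)
open +-*-Solver using (solve; _:=_; _:+_; _:*_; _:-_)

-- Rational arithmetic

p<q+r⇒p-q<r : ∀ p q r → p ℚ.< q ℚ.+ r → p ℚ.- q ℚ.< r
p<q+r⇒p-q<r p q r lt = subst (p ℚ.- q ℚ.<_)
  (trans (cong (ℚ._- q) (ℚ.+-comm q r)) (//-rightDividesʳ q r)) (ℚ.+-monoˡ-< (ℚ.- q) lt)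

p-q<r⇒p<q+r : ∀ p q r → p ℚ.- q ℚ.< r → p ℚ.< q ℚ.+ r
p-q<r⇒p<q+r p q r lt = subst (ℚ._< q ℚ.+ r)
  (trans (ℚ.+-comm q (p ℚ.- q)) (//-rightDividesˡ q p)) (ℚ.+-monoʳ-< q lt)

-- Density is used twice: `r` is taken between `t - u` and `v`, then `s` between `t - r` and `u`.
split-< : ∀ t u v → t ℚ.< u ℚ.+ v →
          ∃[ s ] ∃[ r ] (s ℚ.< u × r ℚ.< v × t ℚ.< s ℚ.+ r)
split-< t u v t<u+v =
  let r , t-u<r , r<v = ℚ.<-dense (p<q+r⇒p-q<r t u v t<u+v)
      t<r+u = subst (t ℚ.<_) (ℚ.+-comm u r) (p-q<r⇒p<q+r t u r t-u<r)
      s , t-r<s , s<u = ℚ.<-dense (p<q+r⇒p-q<r t r u t<r+u)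
  in s , r , s<u , r<v , subst (t ℚ.<_) (ℚ.+-comm r s) (p-q<r⇒p<q+r t r s t-r<s)

<⇒≱ : ∀ {p q} → p ℚ.< q → ¬ (q ℚ.≤ p)
<⇒≱ p<q q≤p = ℚ.<-irrefl refl (ℚ.<-≤-trans p<q q≤p)

0≤* : ∀ {p q} → 0ℚ ℚ.≤ p → 0ℚ ℚ.≤ q → 0ℚ ℚ.≤ p ℚ.* q
0≤* {p} {q} 0≤p 0≤q = subst (ℚ._≤ p ℚ.* q) (ℚ.*-zeroʳ p)
  (ℚ.*-monoˡ-≤-nonNeg p {{ℚ.nonNegative 0≤p}} 0≤q)

*-monoʳ : ∀ r {p q} → 0ℚ ℚ.≤ r → p ℚ.≤ q → p ℚ.* r ℚ.≤ q ℚ.* r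
*-monoʳ r 0≤r = ℚ.*-monoʳ-≤-nonNeg r {{ℚ.nonNegative 0≤r}}

*-monoˡ : ∀ r {p q} → 0ℚ ℚ.≤ r → p ℚ.≤ q → r ℚ.* p ℚ.≤ r ℚ.* q
*-monoˡ r 0≤r = ℚ.*-monoˡ-≤-nonNeg r {{ℚ.nonNegative 0≤r}}

0≤½ : 0ℚ ℚ.≤ ½
0≤½ = ℚ.nonNegative⁻¹ ½

½p+½p≡p : ∀ p → ½ ℚ.* p ℚ.+ ½ ℚ.* p ≡ p
½p+½p≡p p = trans (sym (ℚ.*-distribʳ-+ p ½ ½)) (ℚ.*-identityˡ p)

p-1<p : ∀ p → p ℚ.- 1ℚ ℚ.< p
p-1<p p = subst (p ℚ.- 1ℚ ℚ.<_) (ℚ.+-identityʳ p) (ℚ.+-monoʳ-< p (ℚ.negative⁻¹ (ℚ.- 1ℚ)))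

fromNat : ℕ → ℚ
fromNat n = + n ℚ./ 1

toℚᵘ-fromNat : ∀ n → ℚ.toℚᵘ (fromNat n) ℚᵘ.≃ ℚᵘ.mkℚᵘ (+ n) 0
toℚᵘ-fromNat n = ℚ.toℚᵘ-fromℚᵘ (ℚᵘ.mkℚᵘ (+ n) 0)

fromNat-suc : ∀ n → fromNat (suc n) ≡ 1ℚ ℚ.+ fromNat n
fromNat-suc n = ℚ.toℚᵘ-injective (ℚᵘ.≃-trans (toℚᵘ-fromNat (suc n))
  (ℚᵘ.≃-sym (ℚᵘ.≃-trans (ℚ.toℚᵘ-homo-+ 1ℚ (fromNat n))
    (ℚᵘ.≃-trans (ℚᵘ.+-congʳ ℚᵘ.1ℚᵘ (toℚᵘ-fromNat n))
      (ℚᵘ.*≡* (cong (λ k → (+ 1 ℤ.+ k) ℤ.* + 1) (ℤ.*-identityʳ (+ n))))))))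

fromNat-mono : ∀ {m n} → m ℕ.≤ n → fromNat m ℚ.≤ fromNat n
fromNat-mono {m} {n} m≤n = ℚ.toℚᵘ-cancel-≤
  (ℚᵘ.≤-trans (ℚᵘ.≤-reflexive (toℚᵘ-fromNat m))
    (ℚᵘ.≤-trans (ℚᵘ.*≤* (ℤ.*-monoʳ-≤-nonNeg (+ 1) (ℤ.+≤+ m≤n)))
      (ℚᵘ.≤-reflexive (ℚᵘ.≃-sym (toℚᵘ-fromNat n)))))

archimedean : ∀ {ε} p → 0ℚ ℚ.< ε → ∃[ k ] p ℚ.≤ fromNat k ℚ.* ε
archimedean {mkℚ (+ 0) _ _} p 0<ε with () ← ℚ.positive 0<ε
archimedean {ε@(mkℚ -[1+ _ ] _ _)} p 0<ε = contradiction 0<ε (ℚ.<-asym (ℚ.negative⁻¹ ε))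
archimedean {ε@(mkℚ (+ suc n) d _)} p@(mkℚ a b _) _ = k , ℚ.toℚᵘ-cancel-≤
  (ℚᵘ.≤-trans (ℚᵘ.*≤* num≤)
    (ℚᵘ.≤-reflexive (ℚᵘ.≃-sym (ℚᵘ.≃-trans (ℚ.toℚᵘ-homo-* (fromNat k) ε)
      (ℚᵘ.*-congʳ {ℚ.toℚᵘ ε} (toℚᵘ-fromNat k))))))
  where
  -- The factor `suc d` cancels the denominator of `ε`, so `k` times `ε` is the integer |a| (n + 1),
  -- which is at least `p`.
  k = ℤ.∣ a ∣ ℕ.* suc d
  i≤∣i∣ : ∀ i → i ℤ.≤ + ℤ.∣ i ∣
  i≤∣i∣ (+ _)    = ℤ.≤-refl
  i≤∣i∣ -[1+ _ ] = ℤ.-≤+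
  num≤ : a ℤ.* (+ suc (d ℕ.+ 0)) ℤ.≤ + k ℤ.* + suc n ℤ.* + suc b
  num≤ = begin
    a ℤ.* (+ suc (d ℕ.+ 0))         ≡⟨ cong (λ e → a ℤ.* + suc e) (ℕ.+-identityʳ d) ⟩
    a ℤ.* (+ suc d)                 ≤⟨ ℤ.*-monoʳ-≤-nonNeg (+ suc d) (i≤∣i∣ a) ⟩
    + ℤ.∣ a ∣ ℤ.* (+ suc d)         ≡⟨ sym (ℤ.pos-* ℤ.∣ a ∣ (suc d)) ⟩
    + k                             ≤⟨ ℤ.+≤+ (ℕ.m≤m*n k (suc n)) ⟩
    + (k ℕ.* suc n)                 ≤⟨ ℤ.+≤+ (ℕ.m≤m*n (k ℕ.* suc n) (suc b)) ⟩
    + (k ℕ.* suc n ℕ.* suc b)       ≡⟨ ℤ.pos-* (k ℕ.* suc n) (suc b) ⟩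
    + (k ℕ.* suc n) ℤ.* + suc b     ≡⟨ cong (ℤ._* + suc b) (ℤ.pos-* k (suc n)) ⟩
    + k ℤ.* + suc n ℤ.* + suc b     ∎
    where open ℤ.≤-Reasoning

-- Dedekind cuts

private
  variable
    a a′ b b′ c : ℝ∞

≤-refl : a ≤ a
≤-refl _ a∋q = a∋q

≤-trans : a ≤ b → b ≤ c → a ≤ c
≤-trans a≤b b≤c q a∋q = b≤c q (a≤b q a∋q)

-- Cuts are downward closed, so a rational outside `a` is an upper bound of `a`.
Bounded : ℝ∞ → Set
Bounded a = ∃[ q ] ¬ (a ∋ q)

∋∌⇒< : ∀ {p q} → a ∋ p → ¬ (a ∋ q) → p ℚ.< q
∋∌⇒< {a} {p} {q} a∋p a∌q with ℚ.<-cmp p q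
... | tri< p<q _    _   = p<q
... | tri≈ _   refl _   = contradiction a∋p a∌q
... | tri> _   _    q<p = contradiction (ℝ∞.down a q<p a∋p) a∌q

<⇒∋ : ∀ {p q} → p ℚ.< q → fromℚ q ∋ p
<⇒∋ p<q = _ , p<q , refl

∋⇒< : ∀ {p q} → fromℚ q ∋ p → p ℚ.< q
∋⇒< (_ , p<q , refl) = p<q

∋⇒fromℚ≤ : ∀ {q} → a ∋ q → fromℚ q ≤ a
∋⇒fromℚ≤ {a} a∋q _ = λ (_ , p<q , eq) → ℝ∞.down a p<q (subst (a ∋_) eq a∋q)

∌⇒≤fromℚ : ∀ {q} → ¬ (a ∋ q) → a ≤ fromℚ q
∌⇒≤fromℚ {a} a∌q _ a∋p = <⇒∋ (∋∌⇒< {a} a∋p a∌q)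

fromℚ-∌ : ∀ {q} → ¬ (fromℚ q ∋ q)
fromℚ-∌ q∋q = ℚ.<-irrefl refl (∋⇒< q∋q)

fromℚ-mono : ∀ {p q} → p ℚ.≤ q → fromℚ p ≤ fromℚ q
fromℚ-mono p≤q _ p∋r = <⇒∋ (ℚ.<-≤-trans (∋⇒< p∋r) p≤q)

fromℚ-cancel : ∀ {p q} → fromℚ p ≤ fromℚ q → p ℚ.≤ q
fromℚ-cancel {p} {q} p≤q = ℚ.≮⇒≥ λ q<p → fromℚ-∌ (p≤q q (<⇒∋ q<p))

Bounded-≤ : a ≤ b → Bounded b → Bounded a
Bounded-≤ a≤b (q , b∌q) = q , λ a∋q → b∌q (a≤b q a∋q)

0≤∌ : ∀ {q} → 0∞ ≤ a → ¬ (a ∋ q) → 0ℚ ℚ.≤ q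
0≤∌ {q = q} 0≤a a∌q = ℚ.≮⇒≥ λ q<0 → a∌q (0≤a q (<⇒∋ q<0))

∋0≤⇒0< : ∀ {q} → 0ℚ ℚ.≤ q → a ∋ q → 0∞ < a
∋0≤⇒0< 0≤q a∋q = _ , a∋q , λ 0∋q → <⇒≱ (∋⇒< 0∋q) 0≤q

+-∋ : ∀ {u v t} → a ∋ u → b ∋ v → t ℚ.< u ℚ.+ v → (a + b) ∋ t
+-∋ a∋u b∋v t<u+v = _ , t<u+v , _ , _ , a∋u , b∋v , refl

+-mono : a ≤ a′ → b ≤ b′ → (a + b) ≤ (a′ + b′)
+-mono a≤ b≤ _ (q , p<q , u , v , a∋u , b∋v , eq) =
  q , p<q , u , v , a≤ u a∋u , b≤ v b∋v , eq

+-fromℚ : ∀ {u v} → (fromℚ u + fromℚ v) ≤ fromℚ (u ℚ.+ v)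
+-fromℚ _ (_ , p<q , _ , _ , u∋ , v∋ , refl) =
  <⇒∋ (ℚ.<-trans p<q (ℚ.+-mono-< (∋⇒< u∋) (∋⇒< v∋)))

fromℚ-+ : ∀ {u v} → fromℚ u ≤ a → fromℚ v ≤ b → fromℚ (u ℚ.+ v) ≤ (a + b)
fromℚ-+ {a} {b} {u} {v} u≤a v≤b t t∋ =
  let s , r , s<u , r<v , t<s+r = split-< t u v (∋⇒< t∋)
  in +-∋ {a} {b} (u≤a s (<⇒∋ s<u)) (v≤b r (<⇒∋ r<v)) t<s+r

-- Roundedness puts some `q` of the cut strictly above any given element, which reduces inequalities
-- of cuts to rational arithmetic.
≤-via-rationals : (∀ {q} → a ∋ q → fromℚ q ≤ b) → a ≤ b
≤-via-rationals {a} a⇒b p a∋p =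
  let q , p<q , a∋q = ℝ∞.rounded a a∋p in a⇒b a∋q p (<⇒∋ p<q)

a≤a+b : 0∞ ≤ b → a ≤ (a + b)
a≤a+b {b} {a} 0≤b = ≤-via-rationals {a} {a + b} λ {q} a∋q →
  subst (λ r → fromℚ r ≤ (a + b)) (ℚ.+-identityʳ q)
    (fromℚ-+ {a} {b} (∋⇒fromℚ≤ {a} a∋q) 0≤b)

b≤a+b : 0∞ ≤ a → b ≤ (a + b)
b≤a+b {a} {b} 0≤a = ≤-via-rationals {b} {a + b} λ {q} b∋q →
  subst (λ r → fromℚ r ≤ (a + b)) (ℚ.+-identityˡ q)
    (fromℚ-+ {a} {b} 0≤a (∋⇒fromℚ≤ {b} b∋q))

-- Each rational generating the product is 0 or comes from some `u ≥ 0` in `a`, and this `u`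
-- witnesses `0∞ < a`. Responses of probability 0 can therefore be ignored in expectations.
·-monoʳ : (0∞ < a → b ≤ b′) → (a · b) ≤ (a · b′)
·-monoʳ     b≤ _ (q , p<q , inj₁ q≡0) = q , p<q , inj₁ q≡0
·-monoʳ {a} b≤ _ (q , p<q , inj₂ (u , v , 0≤u , 0≤v , a∋u , b∋v , eq)) =
  q , p<q , inj₂ (u , v , 0≤u , 0≤v , a∋u , b≤ (∋0≤⇒0< {a} 0≤u a∋u) v b∋v , eq)

-- The hypothesis 0 ≤ c serves only to exclude that c and q are both negative.
fromℚ·-∋ : ∀ {c q v} → 0ℚ ℚ.≤ c → a ∋ q → v ℚ.< c ℚ.* q → (fromℚ c · a) ∋ v
fromℚ·-∋ {a} {c} {q} {v} 0≤c a∋q v<cq with v ℚ.<? 0ℚ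
... | yes v<0 = 0ℚ , v<0 , inj₁ refl
... | no  v≮0 =
  let v′ , v<v′ , v′<cq = ℚ.<-dense v<cq
      0<v′   = ℚ.≤-<-trans (ℚ.≮⇒≥ v≮0) v<v′
      0<q    = ℚ.≰⇒> λ q≤0 → <⇒≱ (ℚ.<-trans 0<v′ v′<cq)
                 (subst (c ℚ.* q ℚ.≤_) (ℚ.*-zeroʳ c) (*-monoˡ c 0≤c q≤0))
      pos    = ℚ.positive 0<q
      nz     = ℚ.pos⇒nonZero q {{pos}}
      1/q    = ℚ.1/_ q {{nz}}
      u      = v′ ℚ.* 1/q
      uq≡v′  = trans (ℚ.*-assoc v′ 1/q q)
                 (trans (cong (v′ ℚ.*_) (ℚ.*-inverseˡ q {{nz}})) (ℚ.*-identityʳ v′))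
      0≤u    = 0≤* (ℚ.<⇒≤ 0<v′) (ℚ.<⇒≤ (ℚ.positive⁻¹ 1/q {{ℚ.1/pos⇒pos q {{pos}}}}))
      u<c    = ℚ.*-cancelʳ-<-nonNeg q {{ℚ.pos⇒nonNeg q {{pos}}}}
                 (subst (ℚ._< c ℚ.* q) (sym uq≡v′) v′<cq)
  in v′ , v<v′ , inj₂ (u , q , 0≤u , ℚ.<⇒≤ 0<q , <⇒∋ u<c , a∋q , sym uq≡v′)

fromℚ≤fromℚ·a : ∀ {c q} → 0ℚ ℚ.≤ c → a ∋ q → fromℚ (c ℚ.* q) ≤ (fromℚ c · a)
fromℚ≤fromℚ·a {a} 0≤c a∋q _ t∋ = fromℚ·-∋ {a} 0≤c a∋q (∋⇒< t∋)

a≤1·a : a ≤ (1∞ · a)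
a≤1·a {a} = ≤-via-rationals {a} {1∞ · a} λ {q} a∋q →
  subst (λ r → fromℚ r ≤ (1∞ · a)) (ℚ.*-identityˡ q)
    (fromℚ≤fromℚ·a {a} (ℚ.nonNegative⁻¹ 1ℚ) a∋q)

-- Trades a product of cuts for a product of rationals: the element `u` of `a` serves as the weight,
-- and the default generator 0 gets weight 0.
·-weight : ∀ {e v} → 0∞ ≤ a → 0ℚ ℚ.≤ e → (0∞ < a → ¬ (b ∋ e)) → (a · b) ∋ v →
           ∃[ w ] (fromℚ w ≤ a × v ℚ.≤ w ℚ.* e)
·-weight {e = e} {v} 0≤a 0≤e b∌e (_ , v<q , inj₁ refl) =
  0ℚ , 0≤a , subst (v ℚ.≤_) (sym (ℚ.*-zeroˡ e)) (ℚ.<⇒≤ v<q)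
·-weight {a} {b} 0≤a 0≤e b∌e (_ , v<q , inj₂ (u , t , 0≤u , 0≤t , a∋u , b∋t , refl)) =
  u , ∋⇒fromℚ≤ {a} a∋u ,
  ℚ.≤-trans (ℚ.<⇒≤ v<q) (*-monoˡ u 0≤u (ℚ.<⇒≤ (∋∌⇒< {b} b∋t (b∌e (∋0≤⇒0< {a} 0≤u a∋u)))))

sup-≤ : {I : Set} (f : I → ℝ∞) → (∀ i → f i ≤ b) → sup f ≤ b
sup-≤ {b} f f≤b _ (q , p<q , i , fi∋q) = ℝ∞.down b p<q (f≤b i q fi∋q)

≤-sup : {I : Set} (f : I → ℝ∞) (i : I) → f i ≤ sup f
≤-sup f i q fi∋q = let q′ , q<q′ , fi∋q′ = ℝ∞.rounded (f i) fi∋q in q′ , q<q′ , i , fi∋q′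

-- Sums

∑-nonNeg : {A : Set} (f : A → ℝ∞) → (∀ x → 0∞ ≤ f x) → ∀ xs → 0∞ ≤ ∑ xs f
∑-nonNeg f 0≤f []       = ≤-refl {0∞}
∑-nonNeg f 0≤f (x ∷ xs) =
  ≤-trans {0∞} {f x} {f x + ∑ xs f} (0≤f x) (a≤a+b {∑ xs f} {f x} (∑-nonNeg f 0≤f xs))

∑-mono : {A : Set} {f g : A → ℝ∞} {xs : List A} →
         All (λ x → f x ≤ g x) xs → ∑ xs f ≤ ∑ xs g
∑-mono                           []           = ≤-refl {0∞}
∑-mono {f = f} {g} {xs = x ∷ xs} (f≤g ∷ f≤gs) =
  +-mono {f x} {g x} {∑ xs f} {∑ xs g} f≤g (∑-mono {f = f} {g} f≤gs)

term≤∑ : {A : Set} (f : A → ℝ∞) → (∀ x → 0∞ ≤ f x) →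
         ∀ {x xs} → x ∈ˡ xs → f x ≤ ∑ xs f
term≤∑ f 0≤f {x} {_ ∷ xs} (here refl)  = a≤a+b {∑ xs f} {f x} (∑-nonNeg f 0≤f xs)
term≤∑ f 0≤f {x} {y ∷ xs} (there x∈xs) =
  ≤-trans {f x} {∑ xs f} {f y + ∑ xs f} (term≤∑ f 0≤f x∈xs) (b≤a+b {f y} {∑ xs f} (0≤f y))

∑≤∑∞ : {A : Set} (f : A → ℝ∞) {xs : List A} → Unique xs → ∑ xs f ≤ ∑∞ f
∑≤∑∞ f {xs} !xs q ∑∋q =
  let q′ , q<q′ , ∑∋q′ = ℝ∞.rounded (∑ xs f) ∑∋q in q′ , q<q′ , (xs , !xs) , ∑∋q′

term≤∑∞ : {A : Set} (f : A → ℝ∞) (x : A) → f x ≤ ∑∞ f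
term≤∑∞ f x = ≤-trans {f x} {f x + 0∞} {∑∞ f}
  (a≤a+b {0∞} {f x} (≤-refl {0∞})) (∑≤∑∞ f {x ∷ []} ([] ∷ []))

∑∞-nonNeg : {A : Set} (f : A → ℝ∞) → 0∞ ≤ ∑∞ f
∑∞-nonNeg f = ∑≤∑∞ f {[]} []

∑∞-mono : {A : Set} {f g : A → ℝ∞} → (∀ x → f x ≤ g x) → ∑∞ f ≤ ∑∞ g
∑∞-mono {f = f} {g} f≤g = sup-≤ {∑∞ g} (λ (xs , _) → ∑ xs f) λ (xs , !xs) →
  ≤-trans {∑ xs f} {∑ xs g} {∑∞ g} (∑-mono {f = f} {g} (All.universal f≤g xs)) (∑≤∑∞ g !xs)

-- Averages

-- The weights supplied by `·-weight` add up, and their total stays below the total of `p`.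
∑-weight : {A : Set} (p f : A → ℝ∞) (xs : List A) → ∀ {e v} →
           (∀ x → 0∞ ≤ p x) → 0ℚ ℚ.≤ e → (∀ x → 0∞ < p x → ¬ (f x ∋ e)) →
           ∑ xs (λ x → p x · f x) ∋ v →
           ∃[ w ] (fromℚ w ≤ ∑ xs p × v ℚ.≤ w ℚ.* e)
∑-weight p f [] {e} {v} 0≤p 0≤e f∌e 0∋v =
  0ℚ , ≤-refl {0∞} , subst (v ℚ.≤_) (sym (ℚ.*-zeroˡ e)) (ℚ.<⇒≤ (∋⇒< 0∋v))
∑-weight p f (x ∷ xs) {e} {v} 0≤p 0≤e f∌e (_ , v<q , s , t , px∋s , ∑∋t , refl) =
  let w₁ , w₁≤ , s≤ = ·-weight {p x} {f x} (0≤p x) 0≤e (f∌e x) px∋s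
      w₂ , w₂≤ , t≤ = ∑-weight p f xs 0≤p 0≤e f∌e ∑∋t
  in w₁ ℚ.+ w₂ , fromℚ-+ {p x} {∑ xs p} w₁≤ w₂≤ ,
     subst (v ℚ.≤_) (sym (ℚ.*-distribʳ-+ e w₁ w₂))
       (ℚ.≤-trans (ℚ.<⇒≤ v<q) (ℚ.+-mono-≤ s≤ t≤))

w*e≤e : ∀ w {e} → 0ℚ ℚ.≤ e → w ℚ.≤ 1ℚ → w ℚ.* e ℚ.≤ e
w*e≤e w {e} 0≤e w≤1 = subst (w ℚ.* e ℚ.≤_) (ℚ.*-identityˡ e) (*-monoʳ e 0≤e w≤1)

-- A weighted average with weight at least u on a value at most q and all other
-- values at most e falls short of e by u (e − q).
average-gap : ∀ u w₀ w q e v → u ℚ.≤ w₀ → w₀ ℚ.+ w ℚ.≤ 1ℚ → q ℚ.≤ e → 0ℚ ℚ.≤ e →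
              v ℚ.≤ w₀ ℚ.* q ℚ.+ w ℚ.* e → v ℚ.+ u ℚ.* (e ℚ.- q) ℚ.≤ e
average-gap u w₀ w q e v u≤w₀ w₀+w≤1 q≤e 0≤e v≤ = begin
  v ℚ.+ u ℚ.* (e ℚ.- q)
    ≤⟨ ℚ.+-mono-≤ v≤ (*-monoʳ (e ℚ.- q) 0≤e-q u≤w₀) ⟩
  w₀ ℚ.* q ℚ.+ w ℚ.* e ℚ.+ w₀ ℚ.* (e ℚ.- q)
    ≡⟨ solve 4 (λ w₀ w q e → w₀ :* q :+ w :* e :+ w₀ :* (e :- q) := (w₀ :+ w) :* e)
         refl w₀ w q e ⟩
  (w₀ ℚ.+ w) ℚ.* e
    ≤⟨ w*e≤e (w₀ ℚ.+ w) 0≤e w₀+w≤1 ⟩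
  e ∎
  where
  open ℚ.≤-Reasoning
  0≤e-q : 0ℚ ℚ.≤ e ℚ.- q
  0≤e-q = subst (ℚ._≤ e ℚ.- q) (ℚ.+-inverseʳ q) (ℚ.+-monoˡ-≤ (ℚ.- q) q≤e)

-- If every rational upper bound could be lowered by ε, then iterating would
-- push them below the element q.
no-descent : ∀ {ε q} → Bounded a → 0ℚ ℚ.< ε → a ∋ q →
             ¬ (∀ e → ¬ (a ∋ e) → ∀ v → a ∋ v → v ℚ.+ ε ℚ.≤ e)
no-descent {a} {ε} {q} (b , a∌b) 0<ε a∋q lower = climb k a∌q+kε
  where
  level : ℕ → ℚ
  level k = q ℚ.+ fromNat k ℚ.* ε

  level-suc : ∀ k → level (suc k) ≡ level k ℚ.+ ε
  level-suc k = begin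
    q ℚ.+ fromNat (suc k) ℚ.* ε        ≡⟨ cong (λ n → q ℚ.+ n ℚ.* ε) (fromNat-suc k) ⟩
    q ℚ.+ (1ℚ ℚ.+ fromNat k) ℚ.* ε     ≡⟨ cong (q ℚ.+_) (ℚ.*-distribʳ-+ ε 1ℚ (fromNat k)) ⟩
    q ℚ.+ (1ℚ ℚ.* ε ℚ.+ fromNat k ℚ.* ε) ≡⟨ cong (q ℚ.+_) (ℚ.+-comm (1ℚ ℚ.* ε) _) ⟩
    q ℚ.+ (fromNat k ℚ.* ε ℚ.+ 1ℚ ℚ.* ε)
      ≡⟨ cong (λ e → q ℚ.+ (fromNat k ℚ.* ε ℚ.+ e)) (ℚ.*-identityˡ ε) ⟩
    q ℚ.+ (fromNat k ℚ.* ε ℚ.+ ε)      ≡⟨ sym (ℚ.+-assoc q _ ε) ⟩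
    level k ℚ.+ ε                      ∎
    where open ≡-Reasoning

  climb : ∀ k → ¬ ¬ (a ∋ level k)
  climb zero    a∌ = a∌ (subst (a ∋_)
    (sym (trans (cong (q ℚ.+_) (ℚ.*-zeroˡ ε)) (ℚ.+-identityʳ q))) a∋q)
  climb (suc k) a∌ = climb k λ a∋ →
    let v , lt , a∋v = ℝ∞.rounded a a∋
    in <⇒≱ (ℚ.+-monoˡ-< ε lt)
         (subst (v ℚ.+ ε ℚ.≤_) (level-suc k) (lower (level (suc k)) a∌ v a∋v))

  k : ℕ
  k = proj₁ (archimedean (b ℚ.- q) 0<ε)

  b≤level : b ℚ.≤ level k
  b≤level = subst (ℚ._≤ level k)
    (trans (ℚ.+-comm q (b ℚ.- q)) (//-rightDividesˡ q b))
    (ℚ.+-monoʳ-≤ q (proj₂ (archimedean (b ℚ.- q) 0<ε)))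

  a∌q+kε : ¬ (a ∋ level k)
  a∌q+kε a∋ = <⇒≱ (∋∌⇒< {a} a∋ a∌b) b≤level

-- Means

≤-midpoint : c ≤ a → c ≤ b → c ≤ (fromℚ ½ · a + fromℚ ½ · b)
≤-midpoint {c} {a} {b} c≤a c≤b = ≤-via-rationals {c} {fromℚ ½ · a + fromℚ ½ · b} λ {q} c∋q →
  subst (λ r → fromℚ r ≤ (fromℚ ½ · a + fromℚ ½ · b)) (½p+½p≡p q)
    (fromℚ-+ {fromℚ ½ · a} {fromℚ ½ · b}
      (fromℚ≤fromℚ·a {a} 0≤½ (c≤a q c∋q)) (fromℚ≤fromℚ·a {b} 0≤½ (c≤b q c∋q)))

≤-mean : ∀ n g → (∀ ω → a ≤ g ω) → a ≤ mean n g
≤-mean     zero    g a≤g = a≤g (λ _ → false)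
≤-mean {a} (suc n) g a≤g =
  ≤-midpoint {a} {mean n (g ∘ cons false)} {mean n (g ∘ cons true)}
    (≤-mean {a} n (g ∘ cons false) (a≤g ∘ cons false))
    (≤-mean {a} n (g ∘ cons true)  (a≤g ∘ cons true))

-- Boundedness

-- Bounds conditional probabilities by 1, even if the condition has mass 0: an upper bound `r` of
-- `b` is non-negative, so for `q > 1` the element `q r` of `a` would be at least `r`.
÷-∌1 : a ≤ b → 0∞ ≤ b → ¬ ((a ÷ b) ∋ 1ℚ)
÷-∌1         a≤b 0≤b (_ , 1<q , inj₁ refl) = <⇒≱ 1<q (ℚ.nonNegative⁻¹ 1ℚ)
÷-∌1 {b = b} a≤b 0≤b (q , 1<q , inj₂ (r , b∌r , a∋qr)) =
  <⇒≱ (∋∌⇒< {b} (a≤b _ a∋qr) b∌r) (subst (ℚ._≤ q ℚ.* r) (ℚ.*-identityˡ r)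
    (*-monoʳ r (0≤∌ {b} 0≤b b∌r) (ℚ.<⇒≤ 1<q)))

·-∌ : ∀ {e} → ¬ (a ∋ 1ℚ) → 0ℚ ℚ.≤ e → ¬ (b ∋ e) → ¬ ((a · b) ∋ e)
·-∌             a∌1 0≤e b∌e (_ , e<q , inj₁ refl) = <⇒≱ e<q 0≤e
·-∌ {a} {b} {e} a∌1 0≤e b∌e (_ , e<q , inj₂ (u , v , 0≤u , 0≤v , a∋u , b∋v , refl)) =
  <⇒≱ e<q (ℚ.≤-trans (*-monoˡ u 0≤u (ℚ.<⇒≤ (∋∌⇒< {b} b∋v b∌e)))
    (w*e≤e u 0≤e (ℚ.<⇒≤ (∋∌⇒< {a} a∋u a∌1))))

+-bounded : Bounded a → Bounded b → Bounded (a + b)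
+-bounded {a} {b} (p , a∌p) (q , b∌q) = p ℚ.+ q , λ (_ , <s , u , v , a∋u , b∋v , eq) →
  ℚ.<-asym <s (subst (ℚ._< p ℚ.+ q) (sym eq)
    (ℚ.+-mono-< (∋∌⇒< {a} a∋u a∌p) (∋∌⇒< {b} b∋v b∌q)))

∑-bounded : {A : Set} (f : A → ℝ∞) {xs : List A} → All (Bounded ∘ f) xs → Bounded (∑ xs f)
∑-bounded f               []           = 0ℚ , fromℚ-∌
∑-bounded f {xs = x ∷ xs} (bd ∷ bds) = +-bounded {f x} {∑ xs f} bd (∑-bounded f bds)

rational : ℚ → ℝ
rational q = record
  { ext = fromℚ q
  ; >-∞ = q ℚ.- 1ℚ , <⇒∋ (p-1<p q)
  ; <+∞ = q , fromℚ-∌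
  }

bounded⇒≤real : Bounded a → ∃[ k ] a ≤ ext k
bounded⇒≤real {a} (q , a∌q) = rational q , ∌⇒≤fromℚ {a} a∌q

0≤fromℕ : ∀ n → 0∞ ≤ fromℕ n
0≤fromℕ n = fromℚ-mono {0ℚ} {fromNat n} (fromNat-mono {0} {n} ℕ.z≤n)

fromℕ-mono : ∀ {m n} → m ℕ.≤ n → fromℕ m ≤ fromℕ n
fromℕ-mono {m} {n} m≤n = fromℚ-mono {fromNat m} {fromNat n} (fromNat-mono {m} {n} m≤n)

module _ {σ : ℕ} (xs : List (Str σ)) (f : Str σ → ℝ∞) (bound : Str σ → ℕ)
  (f≤bound : ∀ x → f x ≤ fromℕ (bound x)) where

  𝔼∣-bounded : (𝒟 : Distribution σ) → Bounded (𝔼∣ 𝒟 xs f)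
  𝔼∣-bounded 𝒟 = ∑-bounded (λ x → Pr 𝒟 x ÷ ∑ xs (Pr 𝒟) · f x) {xs} (All.tabulate λ {x} x∈xs →
    fromNat (bound x) ,
    ·-∌ {Pr 𝒟 x ÷ ∑ xs (Pr 𝒟)} {f x} {fromNat (bound x)}
      (÷-∌1 {Pr 𝒟 x} {∑ xs (Pr 𝒟)} (term≤∑ (Pr 𝒟) 0≤Pr {x} {xs} x∈xs) (∑-nonNeg (Pr 𝒟) 0≤Pr xs))
      (fromNat-mono {0} {bound x} ℕ.z≤n)
      (λ f∋ → fromℚ-∌ {fromNat (bound x)} (f≤bound x (fromNat (bound x)) f∋)))
    where
    0≤Pr : ∀ x → 0∞ ≤ Pr 𝒟 x
    0≤Pr = Distribution.nonNegative 𝒟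

  -- The sum of the bounds over the list stands in for their maximum, since each bound is one of its
  -- non-negative terms.
  maxOver-bounded : Bounded (maxOver xs f)
  maxOver-bounded = Bounded-≤ {maxOver xs f} {∑ xs (fromℕ ∘ bound)}
    (sup-≤ {∑ xs (fromℕ ∘ bound)} (λ (x , _) → f x) λ (x , x∈xs) →
      ≤-trans {f x} {fromℕ (bound x)} {∑ xs (fromℕ ∘ bound)} (f≤bound x)
        (term≤∑ (fromℕ ∘ bound) (0≤fromℕ ∘ bound) x∈xs))
    (∑-bounded (fromℕ ∘ bound) {xs}
      (All.universal (λ x → fromNat (bound x) , fromℚ-∌ {fromNat (bound x)}) xs))

-- Point masses

module _ {σ : ℕ} where

  _≟ˢ_ : (s r : Str σ) → Dec (s ≡ r)
  _≟ˢ_ = List.≡-dec Fin._≟_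

  indicator : Str σ → Str σ → ℚ
  indicator y s = if does (s ≟ˢ y) then 1ℚ else 0ℚ

  indicator-self : ∀ y → indicator y y ≡ 1ℚ
  indicator-self y = cong (λ d → if d then 1ℚ else 0ℚ) (dec-true (y ≟ˢ y) refl)

  indicator-nonNeg : ∀ y s → 0∞ ≤ fromℚ (indicator y s)
  indicator-nonNeg y s with does (s ≟ˢ y)
  ... | true  = fromℚ-mono (ℚ.nonNegative⁻¹ 1ℚ)
  ... | false = ≤-refl {0∞}

  indicator-positive : ∀ y s → 0∞ < fromℚ (indicator y s) → s ≡ y
  indicator-positive y s (q , ∋q , 0∌q) with s ≟ˢ y
  ... | yes s≡y = s≡y
  ... | no  _   = contradiction ∋q 0∌q

  ∑-indicator-absent : ∀ y {xs} → All (y ≢_) xs → ∑ xs (fromℚ ∘ indicator y) ≤ 0∞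
  ∑-indicator-absent y                 []           = ≤-refl {0∞}
  ∑-indicator-absent y {xs = x ∷ xs} (y≢x ∷ y∉xs) with x ≟ˢ y
  ... | yes x≡y = contradiction (sym x≡y) y≢x
  ... | no  _   = ≤-trans {0∞ + ∑ xs (fromℚ ∘ indicator y)} {0∞ + 0∞} {0∞}
    (+-mono {0∞} {0∞} {∑ xs (fromℚ ∘ indicator y)} {0∞} (≤-refl {0∞}) (∑-indicator-absent y y∉xs))
    +-fromℚ

  -- In a list without repetition `y` occurs at most once, and all terms after that occurrence are
  -- 0.
  ∑-indicator-≤1 : ∀ y {xs} → Unique xs → ∑ xs (fromℚ ∘ indicator y) ≤ 1∞
  ∑-indicator-≤1 y []                       = fromℚ-mono (ℚ.nonNegative⁻¹ 1ℚ)
  ∑-indicator-≤1 y {x ∷ xs} (x∉xs ∷ !xs) with x ≟ˢ y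
  ... | yes refl = ≤-trans {1∞ + ∑ xs (fromℚ ∘ indicator y)} {1∞ + 0∞} {1∞}
    (+-mono {1∞} {1∞} {∑ xs (fromℚ ∘ indicator y)} {0∞} (≤-refl {1∞}) (∑-indicator-absent y x∉xs))
    +-fromℚ
  ... | no  _    = ≤-trans {0∞ + ∑ xs (fromℚ ∘ indicator y)} {0∞ + 1∞} {1∞}
    (+-mono {0∞} {0∞} {∑ xs (fromℚ ∘ indicator y)} {1∞} (≤-refl {0∞}) (∑-indicator-≤1 y !xs))
    +-fromℚ

  pointMass : Str σ → Distribution σ
  pointMass y = record
    { mass        = rational ∘ indicator y
    ; nonNegative = indicator-nonNeg y
    ; total       = sup-≤ {1∞} (λ (xs , _) → ∑ xs (fromℚ ∘ indicator y))
                      (λ (_ , !xs) → ∑-indicator-≤1 y !xs) ,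
                    subst (λ q → fromℚ q ≤ ∑∞ (fromℚ ∘ indicator y)) (indicator-self y)
                      (term≤∑∞ (fromℚ ∘ indicator y) y)
    }

  -- Copying through an oracle

  Cells : Set
  Cells = List (Symbol σ 0)

  -- Serves as the idle action. The head stays in place, so letters already copied to its left
  -- survive.
  erase : Symbol σ 0 × Move
  erase = blank , S

  -- State 0 copies the input to the query tape and then calls the oracle,
  -- state 1 copies the response to the output tape.
  copier : Machine σ
  copier = record
    { states = 3 ; aux = 0 ; extraWork = 0
    ; start = zero ; halt = suc (suc zero) ; δ = δ }
    where
    δ : Fin 3 → Vec.Vec (Symbol σ 0) 5 → Bool → Action 3 5 σ 0
    δ zero (letter a ∷ _) _ =
      go zero ((letter a , R) ∷ erase ∷ (letter a , R) ∷ erase ∷ erase ∷ []) S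
    δ zero (_ ∷ _) _ = call (suc zero)
    δ (suc zero) (_ ∷ _ ∷ _ ∷ letter a ∷ _) _ =
      go (suc zero) (erase ∷ (letter a , R) ∷ erase ∷ (letter a , R) ∷ erase ∷ []) S
    δ _ _ _ = go (suc (suc zero)) (Vec.replicate 5 erase) S

  letters-map : ∀ (s : Str σ) {rest : Cells} → letters rest ≡ [] →
                letters (map letter s ++ rest) ≡ s
  letters-map []      rest≡[] = rest≡[]
  letters-map (a ∷ s) rest≡[] = cong (a ∷_) (letters-map s rest≡[])

  -- The copied letters lie left of the head, latest first, so reading from the leftmost cell
  -- reverses them; `rest` contributes no letter.
  contents-copied : ∀ (l : Str σ) {rest : Cells} {n} → letters rest ≡ [] →
                    contents (tape (map letter l) rest n) ≡ reverse l
  contents-copied l {rest} rest≡[] =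
    trans (cong (λ c → letters (c ++ rest)) (sym (List.reverse-map letter l)))
      (letters-map (reverse l) rest≡[])

  module Lookup (y : Str σ → Str σ) where

    lookupAOTM : AOTM σ
    lookupAOTM = record { machine = copier ; oracle = pointMass ∘ y }

    open Semantics lookupAOTM

    -- The letters of l are already copied, latest first, those of r still to be
    -- copied.  The erasing steps turn o from [] into blank ∷ [].
    writing : (it qt wt : Tape {σ} {0}) (l : Str σ) (o p : Cells) (r : Str σ) (n m h t : ℕ) →
              List (Str σ × Str σ) → Config
    writing it qt wt l o p r n m h t qs = config (suc zero)
      (it ∷ tape (map letter l) o n ∷ qt ∷ tape p (map letter r) m ∷ wt ∷ []) h t qs

    reading : (rt wt : Tape {σ} {0}) (l r : Str σ) (o : Cells) (n m k h t : ℕ) → Config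
    reading rt wt l r o n m k h t = config zero
      (tape (map letter l) (map letter r) n ∷ tape [] o m ∷ tape (map letter l) [] k ∷ rt ∷ wt ∷ [])
      h t []

    -- One step per remaining letter and one to enter the halting state. The conditions on `o` say
    -- that the output tape carries no letter from the head onwards.
    after-writing : ∀ g ω {it qt wt} l {o p} r {n m h t qs} →
      letters o ≡ [] → drop 1 o ≡ [] →
      after (suc (length r)) ω (writing it qt wt l o p r n m h t qs) (onHalt g) ≡ g (l ʳ++ r)
    after-writing g ω l {o} [] {n} o≡[] o₁≡[] =
      cong g (contents-copied l {blank ∷ drop 1 o} {n} refl)
    after-writing g ω {wt = wt} l {o} (a ∷ r) o≡[] o₁≡[] rewrite o₁≡[] =
      after-writing g ω (a ∷ l) r refl refl

    -- The sum over all responses is bounded below by its single term at `y x`, which has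
    -- probability 1.
    ≤-after-reading : ∀ g ω {x rt wt} l r {o n m k h t} → l ʳ++ r ≡ x →
      letters o ≡ [] → drop 1 o ≡ [] →
      g (y x) ≤ after (suc (length r) ℕ.+ suc (length (y x))) ω
                  (reading rt wt l r o n m k h t) (onHalt g)
    ≤-after-reading g ω l (a ∷ r) lr≡x o≡[] o₁≡[] =
      ≤-after-reading g ω (a ∷ l) r lr≡x refl o₁≡[]
    ≤-after-reading g ω {x} {rt} {wt} l [] {o} {n} {m} {k} {h} {t} refl o≡[] o₁≡[]
      rewrite contents-copied l {[]} {k} refl =
      ≤-trans {g (y x)} {1∞ · g (y x)} {∑∞ term} (a≤1·a {g (y x)})
        (≤-trans {1∞ · g (y x)} {term (y x)} {∑∞ term}
          (subst (λ v → (1∞ · g (y x)) ≤ v) (sym term≡) (≤-refl {1∞ · g (y x)}))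
          (term≤∑∞ term (y x)))
      where
      term : Str σ → ℝ∞
      term r = fromℚ (indicator (y x) r) ·
        after (suc (length (y x))) ω (writing (tape (map letter l) [] n) (tape (map letter l) [] k)
          wt [] o [] r m (scanned rt) h (suc t) ((x , r) ∷ [])) (onHalt g)
      term≡ : term (y x) ≡ 1∞ · g (y x)
      term≡ = cong₂ (λ q v → fromℚ q · v) (indicator-self (y x))
        (after-writing g ω [] (y x) o≡[] o₁≡[])

    ≤-output : ∀ g x → g (y x) ≤ 𝔼output x g
    ≤-output g x = ≤-trans {g (y x)} {mean n value} {𝔼output x g}
      (≤-mean {g (y x)} n value λ ω → ≤-after-reading g ω [] x refl refl refl)
      (≤-sup (λ n → mean n λ ω → after n ω (initial x) (onHalt g)) n)
      where
      -- Copying the input and calling the oracle, then copying the response and halting.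
      n = suc (length x) ℕ.+ suc (length (y x))
      value : RandomTape → ℝ∞
      value ω = after n ω (initial x) (onHalt g)

    -- Invariant of the copier and bounds on its resources

    module _ (x : Str σ) where

      -- The running time on `x`: one step per copied letter, the call and the halting step. It also
      -- bounds the cells scanned on each tape.
      size : ℕ
      size = 2 ℕ.+ (length (y x) ℕ.+ length x)

      Small : ∀ {n} → Vec.Vec (Tape {σ} {0}) n → Set
      Small = VecAll.All (λ t → scanned t ℕ.≤ size)

      -- Describes the configurations that can occur in each of the three states. While copying, the
      -- clock is tied to the number of letters copied; from the call on, the log is the single pair
      -- `(x , y x)`.
      data Visited : Config → Set where
        visit-reading : ∀ {rt wt l r o n m k h} → l ʳ++ r ≡ x →
          letters o ≡ [] → drop 1 o ≡ [] →
          Small (tapeVec (reading rt wt l r o n m k h (length l))) →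
          Visited (reading rt wt l r o n m k h (length l))
        visit-writing : ∀ {it qt wt l o r n m h} → l ʳ++ r ≡ y x →
          letters o ≡ [] → drop 1 o ≡ [] →
          let c = writing it qt wt l o (map letter l) r n m h
                    (suc (length l ℕ.+ length x)) ((x , y x) ∷ [])
          in Small (tapeVec c) → Visited c
        visit-done : ∀ {ts h t} → contents (Vec.lookup ts output) ≡ y x → t ℕ.≤ size →
          Small ts → Visited (config (suc (suc zero)) ts h t ((x , y x) ∷ []))

      prefix-length : ∀ (l : Str σ) a r {s} → l ʳ++ (a ∷ r) ≡ s → suc (length l) ℕ.≤ length s
      prefix-length l a r refl =
        subst (suc (length l) ℕ.≤_) (sym (List.length-ʳ++ l)) (ℕ.m<m+n (length l) ℕ.z<s)

      -- The head moves right only while a letter remains to be copied, so it never passes the cell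
      -- just after the string.
      scanned-shift : ∀ (l : Str σ) a r {s n} → l ʳ++ (a ∷ r) ≡ s →
        length s ℕ.≤ length (y x) ℕ.+ length x →
        n ℕ.≤ size → n ℕ.⊔ (2 ℕ.+ length (map (letter {σ} {0}) l)) ℕ.≤ size
      scanned-shift l a r lr≡s s≤ n≤ rewrite List.length-map (letter {σ} {0}) l =
        ℕ.⊔-lub n≤ (ℕ.s≤s (ℕ.s≤s
          (ℕ.≤-trans (ℕ.n≤1+n _) (ℕ.≤-trans (prefix-length l a r lr≡s) s≤))))

      visited-next : ∀ {ω c c′} → Visited c → step ω c ≡ next c′ → Visited c′
      visited-next (visit-reading {l = l} {a ∷ r} lr≡x o≡[] o₁≡[]
        (n≤ ∷ m≤ ∷ k≤ ∷ r≤ ∷ w≤ ∷ [])) refl =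
        visit-reading {l = a ∷ l} {r} lr≡x refl o₁≡[]
          (scanned-shift l a r lr≡x (ℕ.m≤n+m _ _) n≤ ∷ m≤ ∷
           scanned-shift l a r lr≡x (ℕ.m≤n+m _ _) k≤ ∷ r≤ ∷ w≤ ∷ [])
      visited-next (visit-writing {l = l} {o} {[]} {n} lr≡y _ _ (i≤ ∷ n≤ ∷ q≤ ∷ m≤ ∷ w≤ ∷ [])) refl =
        visit-done (trans (contents-copied l {blank ∷ drop 1 o} {n} refl) lr≡y)
          (ℕ.s≤s (ℕ.s≤s (ℕ.+-monoˡ-≤ (length x) (ℕ.≤-reflexive
            (trans (sym (List.length-reverse l)) (cong length lr≡y))))))
          (i≤ ∷ n≤ ∷ q≤ ∷ m≤ ∷ w≤ ∷ [])
      visited-next (visit-writing {l = l} {o} {r = a ∷ r} lr≡y o≡[] o₁≡[]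
        (i≤ ∷ n≤ ∷ q≤ ∷ m≤ ∷ w≤ ∷ [])) refl =
        visit-writing {l = a ∷ l} {r = r} lr≡y (cong letters o₁≡[]) (cong (drop 1) o₁≡[])
          (i≤ ∷ scanned-shift l a r lr≡y (ℕ.m≤m+n _ _) n≤ ∷ q≤ ∷
           scanned-shift l a r lr≡y (ℕ.m≤m+n _ _) m≤ ∷ w≤ ∷ [])

      visited-reply : ∀ {ω c q k r} → Visited c → step ω c ≡ ask q k →
        0∞ < fromℚ (indicator (y q) r) → Visited (k r)
      visited-reply {r = r} (visit-reading {rt} {wt} {l} {[]} {o} {n} {m} {k} {h}
        lr≡x o≡[] o₁≡[] (n≤ ∷ m≤ ∷ k≤ ∷ r≤ ∷ w≤ ∷ [])) refl 0<r =
        responded (trans (contents-copied l {[]} {k} refl) lr≡x) (indicator-positive _ r 0<r)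
          (trans (sym (List.length-reverse l)) (cong length lr≡x))
        where
        -- Query, response and clock are kept general so that the three equations can be eliminated.
        -- The second holds because only `y q` has positive probability.
        responded : ∀ {q r t} → q ≡ x → r ≡ y q → t ≡ length x → Visited
          (writing (tape (map letter l) [] n) (tape (map letter l) [] k) wt [] o [] r
            m (scanned rt) h (suc t) ((q , r) ∷ []))
        responded refl refl refl =
          visit-writing {l = []} refl o≡[] o₁≡[] (n≤ ∷ m≤ ∷ k≤ ∷ r≤ ∷ w≤ ∷ [])
      visited-reply (visit-reading {r = _ ∷ _} _ _ _ _) ()
      visited-reply (visit-writing {r = []} _ _ _ _) ()
      visited-reply (visit-writing {r = _ ∷ _} _ _ _ _) ()

      visited : ∀ {ω c} → Reachable x ω c → Visited c
      visited begin              = visit-reading refl refl refl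
        (ℕ.s≤s ℕ.z≤n ∷ ℕ.s≤s ℕ.z≤n ∷ ℕ.s≤s ℕ.z≤n ∷ ℕ.s≤s ℕ.z≤n ∷ ℕ.s≤s ℕ.z≤n ∷ [])
      visited (move reach eq)    = visited-next (visited reach) eq
      visited (reply _ reach eq 0<r) = visited-reply (visited reach) eq 0<r

      visited-small : ∀ {c} → Visited c → Small (tapeVec c)
      visited-small (visit-reading _ _ _ small) = small
      visited-small (visit-writing _ _ _ small) = small
      visited-small (visit-done _ _ small)      = small

      visited-space : ∀ {c} → Visited c → space c ℕ.≤ 5 ℕ.* size
      visited-space v = sum-scanned (visited-small v)
        where
        sum-scanned : ∀ {n} {ts : Vec.Vec (Tape {σ} {0}) n} → Small ts →
                      Vec.sum (Vec.map scanned ts) ℕ.≤ n ℕ.* size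
        sum-scanned []       = ℕ.z≤n
        sum-scanned (≤s ∷ small) = ℕ.+-mono-≤ ≤s (sum-scanned small)

      copied-length : ∀ (l r : Str σ) {s} → l ʳ++ r ≡ s → length l ℕ.≤ length s
      copied-length l r refl =
        subst (length l ℕ.≤_) (sym (List.length-ʳ++ l)) (ℕ.m≤m+n _ _)

      visited-time : ∀ {c} → Visited c → time c ℕ.≤ size
      visited-time (visit-reading {l = l} {r} lr≡x _ _ _) =
        ℕ.≤-trans (copied-length l r lr≡x) (ℕ.m≤n+m (length x) (2 ℕ.+ length (y x)))
      visited-time (visit-writing {l = l} {r = r} lr≡y _ _ _) =
        ℕ.≤-trans (ℕ.s≤s (ℕ.+-monoˡ-≤ (length x) (copied-length l r lr≡y))) (ℕ.n≤1+n _)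
      visited-time (visit-done _ t≤ _) = t≤

      visited-calls : ∀ {c} (f : Str σ × Str σ → ℕ) → Visited c →
                      sum (map f (calls c)) ℕ.≤ f (x , y x) ℕ.+ 0
      visited-calls f (visit-reading _ _ _ _) = ℕ.z≤n
      visited-calls f (visit-writing _ _ _ _) = ℕ.≤-refl
      visited-calls f (visit-done _ _ _)      = ℕ.≤-refl

      visited-result : ∀ {c} → Visited c → state c ≡ Machine.halt copier → result c ≡ y x
      visited-result (visit-done eq _ _) _ = eq

-- Comparison of cuts under excluded middle

module Classical (em : ExcludedMiddle 0ℓ) where

  ≤-via-bounds : (∀ {e} → ¬ (b ∋ e) → ¬ (a ∋ e)) → a ≤ b
  ≤-via-bounds {b} bound q a∋q with em {b ∋ q}
  ... | yes b∋q = b∋q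
  ... | no  b∌q = contradiction a∋q (bound b∌q)

  ≰⇒> : ¬ (a ≤ b) → b < a
  ≰⇒> {a} {b} a≰b with em {b < a}
  ... | yes b<a = b<a
  ... | no  b≮a = contradiction (≤-via-bounds {b} {a} λ b∌e a∋e → b≮a (_ , a∋e , b∌e)) a≰b

  <⇒≤ : a < b → a ≤ b
  <⇒≤ {a} {b} (q , b∋q , a∌q) p a∋p = ℝ∞.down b (∋∌⇒< {a} a∋p a∌q) b∋q

  -- Given a rational q in a but not in b, the gap would lower every rational
  -- upper bound e of a by an amount bounded away from 0.
  ≤-via-gap : ∀ {u} → Bounded a → 0∞ ≤ b → 0ℚ ℚ.< u →
              (∀ q e v → 0ℚ ℚ.≤ q → q ℚ.≤ e → ¬ (b ∋ q) → ¬ (a ∋ e) → a ∋ v →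
                v ℚ.+ u ℚ.* (e ℚ.- q) ℚ.≤ e) →
              a ≤ b
  ≤-via-gap {a} {b} {u} a-bd 0≤b 0<u gap q a∋q with em {b ∋ q}
  ... | yes b∋q = b∋q
  ... | no  b∌q =
    let q′ , q<q′ , a∋q′ = ℝ∞.rounded a a∋q
        instance pos = ℚ.positive 0<u
        0<q′-q = subst (ℚ._< q′ ℚ.- q) (ℚ.+-inverseʳ q) (ℚ.+-monoˡ-< (ℚ.- q) q<q′)
        0<ε    = subst (ℚ._< u ℚ.* (q′ ℚ.- q)) (ℚ.*-zeroʳ u) (ℚ.*-monoʳ-<-pos u 0<q′-q)
    in ⊥-elim (no-descent {a} a-bd 0<ε a∋q′ λ e a∌e v a∋v →
      ℚ.≤-trans
        (ℚ.+-monoʳ-≤ v (*-monoˡ u (ℚ.<⇒≤ 0<u)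
          (ℚ.+-monoˡ-≤ (ℚ.- q) (ℚ.<⇒≤ (∋∌⇒< {a} a∋q′ a∌e)))))
        (gap q e v (0≤∌ {b} 0≤b b∌q) (ℚ.<⇒≤ (∋∌⇒< {a} a∋q a∌e)) b∌q a∌e a∋v))

  -- Averages over oracle responses

  module _ {A : Set} (p f : A → ℝ∞) (0≤p : ∀ x → 0∞ ≤ p x) (∑p≤1 : ∑∞ p ≤ 1∞) where

    average-≤ : 0∞ ≤ b → (∀ x → 0∞ < p x → f x ≤ b) → ∑∞ (λ x → p x · f x) ≤ b
    average-≤ {b} 0≤b f≤b = ≤-via-bounds {b} {∑∞ (λ x → p x · f x)}
      λ {e} b∌e (v , e<v , (xs , !xs) , ∑∋v) →
      let 0≤e = 0≤∌ {b} 0≤b b∌e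
          w , w≤∑p , v≤we = ∑-weight p f xs 0≤p 0≤e
            (λ x 0<px fx∋e → b∌e (f≤b x 0<px e fx∋e)) ∑∋v
          w≤1 = fromℚ-cancel (≤-trans {fromℚ w} {∑ xs p} {1∞} w≤∑p
                  (≤-trans {∑ xs p} {∑∞ p} {1∞} (∑≤∑∞ p !xs) ∑p≤1))
      in <⇒≱ e<v (ℚ.≤-trans v≤we (w*e≤e w 0≤e w≤1))

    -- Refines `∑-weight` by bounding the value at `x₀` by `q` instead of `e`. Filtering `x₀` out
    -- lets it be put back exactly once, so that the total weight can be compared with 1 whether or
    -- not `x₀` was listed.
    ∑-weight-at : ∀ x₀ {q e v} xs → Unique xs → 0ℚ ℚ.≤ q → 0ℚ ℚ.≤ e → ¬ (f x₀ ∋ q) →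
      (∀ x → 0∞ < p x → ¬ (f x ∋ e)) → ∑ xs (λ x → p x · f x) ∋ v →
      let others = filter (λ x → ¬? (em {x ≡ x₀})) xs in
      ∃[ w₀ ] ∃[ w ] (fromℚ w₀ ≤ p x₀ × fromℚ w ≤ ∑ others p ×
        v ℚ.≤ w₀ ℚ.* q ℚ.+ w ℚ.* e)
    ∑-weight-at x₀ {q} {e} {v} [] _ 0≤q 0≤e f₀∌q f∌e 0∋v =
      0ℚ , 0ℚ , 0≤p x₀ , ≤-refl {0∞} ,
      subst (v ℚ.≤_) (sym (cong₂ ℚ._+_ (ℚ.*-zeroˡ q) (ℚ.*-zeroˡ e))) (ℚ.<⇒≤ (∋⇒< 0∋v))
    ∑-weight-at x₀ {q} {e} {v} (x ∷ xs) (x∉xs ∷ !xs) 0≤q 0≤e f₀∌q f∌e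
      (_ , v<s+t , s , t , px∋s , ∑∋t , refl) with em {x ≡ x₀}
    ... | yes refl =
      let w₀ , w₀≤ , s≤ = ·-weight {p x} {f x} (0≤p x) 0≤q (λ _ → f₀∌q) px∋s
          w  , w≤  , t≤ = ∑-weight p f xs 0≤p 0≤e f∌e ∑∋t
          -- By uniqueness `x₀` does not recur, so filtering leaves the tail unchanged.
          others≡xs = filter-all (λ y → ¬? (em {y ≡ x})) (All.map ≢-sym x∉xs)
      in w₀ , w , w₀≤ , subst (λ ys → fromℚ w ≤ ∑ ys p) (sym others≡xs) w≤ ,
         ℚ.≤-trans (ℚ.<⇒≤ v<s+t) (ℚ.+-mono-≤ s≤ t≤)
    ... | no x≢x₀ =
      let w₁ , w₁≤ , s≤ = ·-weight {p x} {f x} (0≤p x) 0≤e (f∌e x) px∋s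
          w₀ , w , w₀≤ , w≤ , t≤ = ∑-weight-at x₀ xs !xs 0≤q 0≤e f₀∌q f∌e ∑∋t
          others = filter (λ y → ¬? (em {y ≡ x₀})) xs
      in w₀ , w₁ ℚ.+ w , w₀≤ , fromℚ-+ {p x} {∑ others p} w₁≤ w≤ ,
         ℚ.≤-trans (ℚ.<⇒≤ v<s+t) (subst (s ℚ.+ t ℚ.≤_)
           (solve 5 (λ w₁ w₀ w q e → w₁ :* e :+ (w₀ :* q :+ w :* e)
              := w₀ :* q :+ (w₁ :+ w) :* e) refl w₁ w₀ w q e)
           (ℚ.+-mono-≤ s≤ t≤))

    -- A value below `b` at a point of positive weight would keep the average away from the upper
    -- bounds of `b` by a fixed amount, by `average-gap`.
    average-attained : ∀ x₀ → Bounded b → 0∞ ≤ f x₀ → (∀ x → 0∞ < p x → f x ≤ b) →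
      0∞ < p x₀ → b ≤ ∑∞ (λ x → p x · f x) → b ≤ f x₀
    average-attained {b} x₀ b-bd 0≤f₀ f≤b (u , p₀∋u , 0∌u) b≤avg =
      -- So far `u` is only non-negative; a larger element of the cut is a positive weight.
      let u′ , u<u′ , p₀∋u′ = ℝ∞.rounded (p x₀) p₀∋u
          0<u′ = ℚ.≤-<-trans (ℚ.≮⇒≥ λ u<0 → 0∌u (<⇒∋ u<0)) u<u′
      in ≤-via-gap {b} {f x₀} b-bd 0≤f₀ 0<u′ λ q e v 0≤q q≤e f₀∌q b∌e b∋v →
        gap u′ p₀∋u′ q e v 0≤q q≤e f₀∌q b∌e (b≤avg v b∋v)
      where
      gap : ∀ u → p x₀ ∋ u → ∀ q e v → 0ℚ ℚ.≤ q → q ℚ.≤ e → ¬ (f x₀ ∋ q) → ¬ (b ∋ e) →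
            ∑∞ (λ x → p x · f x) ∋ v → v ℚ.+ u ℚ.* (e ℚ.- q) ℚ.≤ e
      gap u p₀∋u q e v 0≤q q≤e f₀∌q b∌e (v′ , v<v′ , (xs , !xs) , ∑∋v′)
        with w₀ , w , w₀≤ , w≤ , v′≤ ← ∑-weight-at x₀ xs !xs 0≤q (ℚ.≤-trans 0≤q q≤e) f₀∌q
               (λ x 0<px fx∋e → b∌e (f≤b x 0<px e fx∋e)) ∑∋v′
        = conclude (ℚ.≤-total u w₀)
        where
        x≢x₀? : ∀ x → Dec (¬ (x ≡ x₀))
        x≢x₀? x = ¬? (em {x ≡ x₀})
        others = filter x≢x₀? xs
        !x₀∷others : Unique (x₀ ∷ others)
        !x₀∷others = All.map ≢-sym (all-filter x≢x₀? xs) ∷ filter⁺ x≢x₀? !xs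
        0≤e = ℚ.≤-trans 0≤q q≤e
        v≤ = ℚ.≤-trans (ℚ.<⇒≤ v<v′) v′≤
        total≤1 : ∀ {w₀} → fromℚ w₀ ≤ p x₀ → w₀ ℚ.+ w ℚ.≤ 1ℚ
        total≤1 {w₀} w₀≤ = fromℚ-cancel
          (≤-trans {fromℚ (w₀ ℚ.+ w)} {∑ (x₀ ∷ others) p} {1∞}
            (fromℚ-+ {p x₀} {∑ others p} w₀≤ w≤)
            (≤-trans {∑ (x₀ ∷ others) p} {∑∞ p} {1∞} (∑≤∑∞ p !x₀∷others) ∑p≤1))
        conclude : (u ℚ.≤ w₀) ⊎ (w₀ ℚ.≤ u) → v ℚ.+ u ℚ.* (e ℚ.- q) ℚ.≤ e
        conclude (inj₁ u≤w₀) = average-gap u w₀ w q e v u≤w₀ (total≤1 w₀≤) q≤e 0≤e v≤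
        -- The finite list may capture less than `u` of the weight at `x₀`. Raising `w₀` to `u`
        -- keeps it below `p x₀` and, as `0 ≤ q`, only weakens the bound on `v`.
        conclude (inj₂ w₀≤u) = average-gap u u w q e v ℚ.≤-refl
          (total≤1 (∋⇒fromℚ≤ {p x₀} p₀∋u)) q≤e 0≤e
          (ℚ.≤-trans v≤ (ℚ.+-monoˡ-≤ (w ℚ.* e) (*-monoʳ q 0≤q w₀≤u)))

  -- Averages over one random bit

  half-weight : ∀ {e v} → 0ℚ ℚ.≤ e → ¬ (a ∋ e) → (fromℚ ½ · a) ∋ v → v ℚ.≤ ½ ℚ.* e
  half-weight {a} {e} 0≤e a∌e ∋v =
    let w , w≤ , v≤ = ·-weight {fromℚ ½} {a} (fromℚ-mono 0≤½) 0≤e (λ _ → a∌e) ∋v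
    in ℚ.≤-trans v≤ (*-monoʳ e 0≤e (fromℚ-cancel w≤))

  midpoint-weight : ∀ {d e v} → 0ℚ ℚ.≤ d → 0ℚ ℚ.≤ e → ¬ (a ∋ d) → ¬ (b ∋ e) →
                (fromℚ ½ · a + fromℚ ½ · b) ∋ v → v ℚ.≤ ½ ℚ.* d ℚ.+ ½ ℚ.* e
  midpoint-weight {a} {b} 0≤d 0≤e a∌d b∌e (_ , v<s+t , s , t , ∋s , ∋t , refl) =
    ℚ.≤-trans (ℚ.<⇒≤ v<s+t)
      (ℚ.+-mono-≤ (half-weight {a} 0≤d a∌d ∋s) (half-weight {b} 0≤e b∌e ∋t))

  midpoint-≤ : 0∞ ≤ c → a ≤ c → b ≤ c → (fromℚ ½ · a + fromℚ ½ · b) ≤ c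
  midpoint-≤ {c} {a} {b} 0≤c a≤c b≤c = ≤-via-bounds {c} {fromℚ ½ · a + fromℚ ½ · b} λ {e} c∌e ∋e →
    let v , e<v , ∋v = ℝ∞.rounded (fromℚ ½ · a + fromℚ ½ · b) ∋e
        0≤e = 0≤∌ {c} 0≤c c∌e
    in <⇒≱ e<v (subst (v ℚ.≤_) (½p+½p≡p e)
         (midpoint-weight {a} {b} 0≤e 0≤e (λ a∋e → c∌e (a≤c e a∋e)) (λ b∋e → c∌e (b≤c e b∋e)) ∋v))

  -- The two-point analogue of `average-attained`: `average-gap` applies with both weights equal to
  -- ½.
  midpoint-attained : Bounded c → 0∞ ≤ a → 0∞ ≤ b → a ≤ c → b ≤ c →
    c ≤ (fromℚ ½ · a + fromℚ ½ · b) → c ≤ a × c ≤ b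
  midpoint-attained {c} {a} {b} c-bd 0≤a 0≤b a≤c b≤c c≤mid =
    ≤-via-gap {c} {a} c-bd 0≤a (ℚ.positive⁻¹ ½) (λ q e v 0≤q q≤e a∌q c∌e c∋v →
      let 0≤e = ℚ.≤-trans 0≤q q≤e in
      average-gap ½ ½ ½ q e v ℚ.≤-refl ℚ.≤-refl q≤e 0≤e
        (midpoint-weight {a} {b} 0≤q 0≤e a∌q (λ b∋e → c∌e (b≤c e b∋e)) (c≤mid v c∋v))) ,
    ≤-via-gap {c} {b} c-bd 0≤b (ℚ.positive⁻¹ ½) (λ q e v 0≤q q≤e b∌q c∌e c∋v →
      let 0≤e = ℚ.≤-trans 0≤q q≤e in
      average-gap ½ ½ ½ q e v ℚ.≤-refl ℚ.≤-refl q≤e 0≤e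
        (subst (v ℚ.≤_) (ℚ.+-comm (½ ℚ.* e) (½ ℚ.* q))
          (midpoint-weight {a} {b} 0≤e 0≤q (λ a∋e → c∌e (a≤c e a∋e)) b∌q (c≤mid v c∋v))))

  -- Expectations

  mean-≤ : ∀ n g → 0∞ ≤ b → (∀ ω → g ω ≤ b) → mean n g ≤ b
  mean-≤     zero    g 0≤b g≤b = g≤b (λ _ → false)
  mean-≤ {b} (suc n) g 0≤b g≤b =
    midpoint-≤ {b} {mean n (g ∘ cons false)} {mean n (g ∘ cons true)} 0≤b
      (mean-≤ {b} n (g ∘ cons false) 0≤b (g≤b ∘ cons false))
      (mean-≤ {b} n (g ∘ cons true)  0≤b (g≤b ∘ cons true))

  Agree : ℕ → RandomTape → RandomTape → Set
  Agree n ω ω′ = ∀ i → i ℕ.< n → ω i ≡ ω′ i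

  Agree-cons : ∀ {n ω ω′} bit → Agree n ω ω′ → Agree (suc n) (cons bit ω) (cons bit ω′)
  Agree-cons bit ag zero    _           = refl
  Agree-cons bit ag (suc i) (ℕ.s≤s i<n) = ag i i<n

  -- Both means draw their common first bits together. Once one side has no bits left it is a
  -- constant, against which the rest of the other is averaged.
  mean-mono : ∀ m n g g′ → (∀ ω → 0∞ ≤ g′ ω) →
              (∀ ω ω′ → Agree (m ℕ.⊓ n) ω ω′ → g ω ≤ g′ ω′) → mean m g ≤ mean n g′
  mean-mono zero    n       g g′ 0≤g′ g≤g′ =
    ≤-mean {g (λ _ → false)} n g′ λ ω → g≤g′ _ ω λ _ ()
  mean-mono (suc m) zero    g g′ 0≤g′ g≤g′ =
    mean-≤ {g′ (λ _ → false)} (suc m) g (0≤g′ _) λ ω → g≤g′ ω _ λ _ ()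
  mean-mono (suc m) (suc n) g g′ 0≤g′ g≤g′ =
    +-mono {half g m false} {half g′ n false} {half g m true} {half g′ n true}
      (rec false) (rec true)
    where
    half : (RandomTape → ℝ∞) → ℕ → Bool → ℝ∞
    half g n bit = fromℚ ½ · mean n (g ∘ cons bit)
    rec : ∀ bit → half g m bit ≤ half g′ n bit
    rec bit = ·-monoʳ {fromℚ ½} {mean m (g ∘ cons bit)} {mean n (g′ ∘ cons bit)} λ _ →
      mean-mono m n (g ∘ cons bit) (g′ ∘ cons bit) (0≤g′ ∘ cons bit)
        λ ω ω′ ag → g≤g′ (cons bit ω) (cons bit ω′) (Agree-cons bit ag)

  -- A mean that reaches the upper bound `b` of its values forces both halves to reach it, bit after
  -- bit, so `k` vanishes on every branch.
  mean-attained : ∀ n g k → Bounded b → (∀ ω → 0∞ ≤ g ω) → (∀ ω → g ω ≤ b) →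
                  (∀ ω → b ≤ g ω → k ω ≤ 0∞) → b ≤ mean n g → mean n k ≤ 0∞
  mean-attained     zero    g k _ _ _ k≤0 b≤g = k≤0 (λ _ → false) b≤g
  mean-attained {b} (suc n) g k b-bd 0≤g g≤b k≤0 b≤mean =
    midpoint-≤ {0∞} {mean n (k ∘ cons false)} {mean n (k ∘ cons true)}
      (≤-refl {0∞}) (rec false (proj₁ both)) (rec true (proj₂ both))
    where
    branch : Bool → ℝ∞
    branch bit = mean n (g ∘ cons bit)
    0≤branch : ∀ bit → 0∞ ≤ branch bit
    0≤branch bit = ≤-mean {0∞} n (g ∘ cons bit) (0≤g ∘ cons bit)
    branch≤b : ∀ bit → branch bit ≤ b
    branch≤b bit = mean-≤ {b} n (g ∘ cons bit)
      (≤-trans {0∞} {g (λ _ → false)} {b} (0≤g _) (g≤b _)) (g≤b ∘ cons bit)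
    both : b ≤ branch false × b ≤ branch true
    both = midpoint-attained {b} {branch false} {branch true} b-bd
      (0≤branch false) (0≤branch true) (branch≤b false) (branch≤b true) b≤mean
    rec : ∀ bit → b ≤ branch bit → mean n (k ∘ cons bit) ≤ 0∞
    rec bit = mean-attained {b} n (g ∘ cons bit) (k ∘ cons bit) b-bd
      (0≤g ∘ cons bit) (g≤b ∘ cons bit) (k≤0 ∘ cons bit)

  -- Runs of an arbitrary machine

  module Expectation {σ : ℕ} (𝓜 : AOTM σ) (x : Str σ) where
    open Semantics 𝓜

    prob : Str σ → Str σ → ℝ∞
    prob q = Pr (oracle q)

    0≤prob : ∀ q r → 0∞ ≤ prob q r
    0≤prob q = Distribution.nonNegative (oracle q)

    ∑prob≤1 : ∀ q → ∑∞ (prob q) ≤ 1∞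
    ∑prob≤1 q = proj₁ (Distribution.total (oracle q))

    after-≤ : ∀ n f {ω c} → 0∞ ≤ b → (∀ {c} → Reachable x ω c → f c ≤ b) →
              Reachable x ω c → after n ω c f ≤ b
    after-≤ zero    f 0≤b f≤b reach = f≤b reach
    after-≤ {b} (suc n) f {ω} {c} 0≤b f≤b reach with step ω c in eq
    ... | halted  = f≤b reach
    ... | next c′ = after-≤ {b} n f 0≤b f≤b (move reach eq)
    ... | ask q k = average-≤ (prob q) (λ r → after n ω (k r) f) (0≤prob q) (∑prob≤1 q) {b} 0≤b
      λ r 0<r → after-≤ {b} n f 0≤b f≤b (reply r reach eq 0<r)

    0≤-after : ∀ n f {ω c} → (∀ {c} → Reachable x ω c → 0∞ ≤ f c) →
               Reachable x ω c → 0∞ ≤ after n ω c f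
    0≤-after zero    f 0≤f reach = 0≤f reach
    0≤-after (suc n) f {ω} {c} 0≤f reach with step ω c in eq
    ... | halted  = 0≤f reach
    ... | next c′ = 0≤-after n f 0≤f (move reach eq)
    ... | ask q k = ∑∞-nonNeg (λ r → prob q r · after n ω (k r) f)

    𝔼run-≤ : ∀ f → 0∞ ≤ b → (∀ {ω c} → Reachable x ω c → f c ≤ b) → 𝔼run x f ≤ b
    𝔼run-≤ {b} f 0≤b f≤b = sup-≤ {b} (λ n → mean n λ ω → after n ω (initial x) f)
      λ n → mean-≤ {b} n (λ ω → after n ω (initial x) f) 0≤b
        λ ω → after-≤ {b} n f 0≤b f≤b begin

    after-halted : ∀ n f {ω c} → state c ≡ Machine.halt machine → after n ω c f ≡ f c
    after-halted zero    f         _      = refl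
    after-halted (suc n) f {ω} {c} isHalt with isHalted c
    ... | yes _     = refl
    ... | no  ¬halt = contradiction isHalt ¬halt

    step-agree : ∀ {ω ω′} c → ω (randomHead c) ≡ ω′ (randomHead c) → step ω c ≡ step ω′ c
    step-agree c eq with isHalted c
    ... | yes _ = refl
    ... | no  _ rewrite eq = refl

    -- Together with `step-agree` and `head-ask`, limits the random bits that a given number of
    -- steps can depend on.
    head-next : ∀ {ω c c′} → step ω c ≡ next c′ → randomHead c′ ℕ.≤ suc (randomHead c)
    head-next {ω} {c} eq with isHalted c
    head-next {ω} {c} () | yes _
    head-next {ω} {c} eq | no _
      with Machine.δ machine (state c) (Vec.map read (tapeVec c)) (ω (randomHead c))
    head-next {c = c} refl | no _ | Action.go _ _ L = ℕ.≤-trans ℕ.pred[n]≤n (ℕ.n≤1+n _)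
    head-next {c = c} refl | no _ | Action.go _ _ R = ℕ.≤-refl
    head-next {c = c} refl | no _ | Action.go _ _ S = ℕ.n≤1+n _

    head-ask : ∀ {ω c q k} → step ω c ≡ ask q k → ∀ r → randomHead (k r) ≡ randomHead c
    head-ask {ω} {c} eq r with isHalted c
    head-ask {ω} {c} () r | yes _
    head-ask {ω} {c} eq r | no _
      with Machine.δ machine (state c) (Vec.map read (tapeVec c)) (ω (randomHead c))
    head-ask refl r | no _ | Action.call _ = refl

  -- Machines all of whose outputs score below a fixed value

  module Averaging {σ : ℕ} (𝓜 : AOTM σ) (x : Str σ) (s : Str σ → ℝ∞) (e : ℝ∞)
    (e-bd : Bounded e) (0≤e : 0∞ ≤ e)
    (0≤s : ∀ {ω c} → Semantics.Reachable 𝓜 x ω c →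
           Run.state c ≡ Machine.halt (AOTM.machine 𝓜) →
           0∞ ≤ s (Run.result (AOTM.machine 𝓜) c))
    (s<e : ∀ {ω c} → Semantics.Reachable 𝓜 x ω c →
           Run.state c ≡ Machine.halt (AOTM.machine 𝓜) →
           s (Run.result (AOTM.machine 𝓜) c) < e)
    where
    open Semantics 𝓜
    open Expectation 𝓜 x

    -- Every unfinished run is credited with the value e, so the expectation of
    -- optimistic at any time is an upper bound of the expected final score.
    optimistic : Config → ℝ∞
    optimistic c = if does (isHalted c) then s (result c) else e

    0≤optimistic : ∀ {ω c} → Reachable x ω c → 0∞ ≤ optimistic c
    0≤optimistic {c = c} reach with isHalted c
    ... | yes isHalt = 0≤s reach isHalt
    ... | no  _      = 0≤e

    optimistic≤e : ∀ {ω c} → Reachable x ω c → optimistic c ≤ e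
    optimistic≤e {c = c} reach with isHalted c
    ... | yes isHalt = <⇒≤ {s (result c)} {e} (s<e reach isHalt)
    ... | no  _      = ≤-refl {e}

    onHalt≤optimistic : ∀ c → onHalt s c ≤ optimistic c
    onHalt≤optimistic c with does (isHalted c)
    ... | true  = ≤-refl {s (result c)}
    ... | false = 0≤e

    optimistic-leaf : ∀ {ω c} → Reachable x ω c → e ≤ optimistic c →
                      onHalt (λ _ → 1∞) c ≤ 0∞
    optimistic-leaf {c = c} reach e≤opt with isHalted c
    ... | yes isHalt = let q , e∋q , s∌q = s<e reach isHalt in
                       contradiction (e≤opt q e∋q) s∌q
    ... | no  _      = ≤-refl {0∞}

    -- By `average-attained` the value `e` passes to the branch of every response of positive
    -- probability, down to configurations that cannot have halted because outputs score below `e`.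
    never-halts : ∀ n {ω c} → Reachable x ω c → e ≤ after n ω c optimistic →
                  after n ω c (onHalt λ _ → 1∞) ≤ 0∞
    never-halts zero            reach e≤ = optimistic-leaf reach e≤
    never-halts (suc n) {ω} {c} reach e≤ with step ω c in eq
    ... | halted  = optimistic-leaf reach e≤
    ... | next c′ = never-halts n (move reach eq) e≤
    ... | ask q k =
      average-≤ (prob q) (λ r → after n ω (k r) (onHalt λ _ → 1∞)) (0≤prob q) (∑prob≤1 q) {0∞}
        (≤-refl {0∞}) λ r 0<r → never-halts n (reply r reach eq 0<r)
          (average-attained (prob q) (λ r → after n ω (k r) optimistic) (0≤prob q) (∑prob≤1 q)
            {e} r e-bd (0≤-after n optimistic 0≤optimistic (reply r reach eq 0<r))
            (λ r 0<r → after-≤ {e} n optimistic 0≤e optimistic≤e (reply r reach eq 0<r)) 0<r e≤)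

    -- A run halted by time `n` keeps its score, and a later score is at most the credit `e`. The
    -- times are independent because the expected score is a supremum over `m`; the tapes need only
    -- share the bits read by both runs.
    after≤optimistic : ∀ m n {ω ω′ c} → Reachable x ω c → Reachable x ω′ c →
      Agree (randomHead c ℕ.+ m ℕ.⊓ n) ω ω′ →
      after m ω c (onHalt s) ≤ after n ω′ c optimistic
    after≤optimistic zero n {ω} {ω′} {c} reach reach′ _ with isHalted c in eq
    ... | no  _      = 0≤-after n optimistic 0≤optimistic reach′
    ... | yes isHalt = subst (s (result c) ≤_)
      (sym (trans (after-halted n optimistic isHalt)
        (cong (λ d → if does d then s (result c) else e) eq))) (≤-refl {s (result c)})
    after≤optimistic (suc m) zero {ω} {ω′} {c} reach reach′ _ = bound (isHalted c) refl
      where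
      bound : ∀ d → isHalted c ≡ d → after (suc m) ω c (onHalt s) ≤ optimistic c
      bound (yes isHalt) _ = subst (_≤ optimistic c)
        (sym (after-halted (suc m) (onHalt s) isHalt)) (onHalt≤optimistic c)
      bound (no _) eq = subst (λ d → after (suc m) ω c (onHalt s) ≤
                                (if does d then s (result c) else e)) (sym eq)
        (after-≤ {e} (suc m) (onHalt s) 0≤e (λ {c} reach → ≤-trans {onHalt s c} {optimistic c} {e}
          (onHalt≤optimistic c) (optimistic≤e reach)) reach)
    after≤optimistic (suc m) (suc n) {ω} {ω′} {c} reach reach′ ag
      with step ω c in eq | step ω′ c in eq′
         | step-agree {ω} {ω′} c (ag (randomHead c) (ℕ.m<m+n (randomHead c) ℕ.z<s))
    ... | halted  | _ | refl = onHalt≤optimistic c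
    ... | next c′ | _ | refl =
      after≤optimistic m n (move reach eq) (move reach′ eq′)
        -- The random head advances by at most one while the remaining common time drops by one.
        λ i i< → ag i (ℕ.<-≤-trans i< (ℕ.≤-trans
          (ℕ.+-monoˡ-≤ (m ℕ.⊓ n) (head-next {ω} {c} eq))
          (ℕ.≤-reflexive (sym (ℕ.+-suc (randomHead c) (m ℕ.⊓ n))))))
    ... | ask q k | _ | refl =
      ∑∞-mono {f = λ r → prob q r · after m ω (k r) (onHalt s)}
              {λ r → prob q r · after n ω′ (k r) optimistic} λ r →
        ·-monoʳ {prob q r} {after m ω (k r) (onHalt s)} {after n ω′ (k r) optimistic} λ 0<r →
          after≤optimistic m n (reply r reach eq 0<r) (reply r reach′ eq′ 0<r)
            λ i i< → ag i (ℕ.<-≤-trans i< (ℕ.+-mono-≤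
              (ℕ.≤-reflexive (head-ask {ω} {c} eq r)) (ℕ.n≤1+n (m ℕ.⊓ n))))

    -- Since optimistic ≤ e, an optimistic value e at time n forces all paths of
    -- positive probability to be still running then.
    e≤optimistic⇒no-halting : ∀ n → e ≤ 𝔼run x (onHalt s) →
      (mean n λ ω → after n ω (initial x) (onHalt λ _ → 1∞)) ≤ 0∞
    e≤optimistic⇒no-halting n e≤𝔼 =
      mean-attained {e} n opt (λ ω → after n ω (initial x) (onHalt λ _ → 1∞)) e-bd
        (λ ω → 0≤-after n optimistic 0≤optimistic begin)
        (λ ω → after-≤ {e} n optimistic 0≤e optimistic≤e begin)
        (λ ω → never-halts n begin)
        (≤-trans {e} {𝔼run x (onHalt s)} {mean n opt} e≤𝔼
          (sup-≤ {mean n opt} (λ m → mean m (score m)) λ m →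
            mean-mono m n (score m) opt
              (λ ω → 0≤-after n optimistic 0≤optimistic begin)
              λ ω ω′ ag → after≤optimistic m n begin begin ag))
      where
      opt : RandomTape → ℝ∞
      opt ω = after n ω (initial x) optimistic
      score : ℕ → RandomTape → ℝ∞
      score m ω = after m ω (initial x) (onHalt s)

    e≤𝔼⇒never-halts : e ≤ 𝔼run x (onHalt s) → 𝔼run x (onHalt λ _ → 1∞) ≤ 0∞
    e≤𝔼⇒never-halts e≤𝔼 = sup-≤ {0∞}
      (λ n → mean n λ ω → after n ω (initial x) (onHalt λ _ → 1∞))
      λ n → e≤optimistic⇒no-halting n e≤𝔼

  -- Choice of a good output

  good-output : ∀ {σ} {𝓜 : AOTM σ} {T : Task σ} → 𝓜 For T → ∀ {x} → Task.X T x →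
    ∃[ y ] (Task.Y T y ×
            Semantics.𝔼output 𝓜 x (λ y → ext (Task.score T x y)) ≤ ext (Task.score T x y))
  good-output {σ} {𝓜} {T} 𝓜-for-T {x} Xx
    with em {∃[ y ] (Task.Y T y ×
      Semantics.𝔼output 𝓜 x (λ y → ext (Task.score T x y)) ≤ ext (Task.score T x y))}
  ... | yes good = good
  -- Halting has probability 1, whose cut contains 0, while `Averaging` makes that probability at
  -- most 0.
  ... | no  none = contradiction (proj₂ halts 0ℚ (<⇒∋ (ℚ.positive⁻¹ 1ℚ))) λ halts∋0 →
    fromℚ-∌ (e≤𝔼⇒never-halts (≤-refl {e}) 0ℚ halts∋0)
    where
    open Task T
    open Semantics 𝓜
    open _For_ 𝓜-for-T renaming (halts to halts-as)
    halts = halts-as Xx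
    s : Str σ → ℝ∞
    s y = ext (score x y)
    e : ℝ∞
    e = 𝔼output x s
    leaf-Y : ∀ {ω c} → Reachable x ω c → state c ≡ Machine.halt machine → Y (result c)
    leaf-Y = output-Y Xx
    0≤onHalt : ∀ {ω c} → Reachable x ω c → 0∞ ≤ onHalt s c
    0≤onHalt {c = c} reach with isHalted c
    ... | yes isHalt = score-0≤ Xx (leaf-Y reach isHalt)
    ... | no  _      = ≤-refl {0∞}
    onHalt≤1 : ∀ {ω c} → Reachable x ω c → onHalt s c ≤ 1∞
    onHalt≤1 {c = c} reach with isHalted c
    ... | yes isHalt = score-≤1 Xx (leaf-Y reach isHalt)
    ... | no  _      = fromℚ-mono (ℚ.nonNegative⁻¹ 1ℚ)
    e≤1 : e ≤ 1∞
    e≤1 = Expectation.𝔼run-≤ 𝓜 x {1∞} (onHalt s) (fromℚ-mono (ℚ.nonNegative⁻¹ 1ℚ)) onHalt≤1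
    0≤e : 0∞ ≤ e
    0≤e = ≤-trans {0∞} {onHalt s (initial x)} {e} (0≤onHalt {λ _ → false} begin)
      (≤-sup (λ n → mean n λ ω → after n ω (initial x) (onHalt s)) 0)
    open Averaging 𝓜 x s e (Bounded-≤ {e} {1∞} e≤1 (1ℚ , fromℚ-∌)) 0≤e
      (λ reach isHalt → score-0≤ Xx (leaf-Y reach isHalt))
      -- An output scoring at least `e` would be good, so all reachable outputs score below `e`.
      (λ {_} {c} reach isHalt → ≰⇒> {e} {s (result c)} λ e≤s →
        none (result c , leaf-Y reach isHalt , e≤s))

  -- Expected costs and correctness of the lookup machine

  module _ {σ : ℕ} (y : Str σ → Str σ) where
    open Lookup y
    open Semantics lookupAOTM

    𝔼TIME-≤ : ∀ x → 𝔼TIME x ≤ fromℕ (size x)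
    𝔼TIME-≤ x = Expectation.𝔼run-≤ lookupAOTM x {fromℕ (size x)} (fromℕ ∘ time)
      (0≤fromℕ (size x)) λ {_} {c} reach →
        fromℕ-mono {time c} {size x} (visited-time x (visited x reach))

    SPACE-≤ : ∀ x → SPACE x ≤ fromℕ (5 ℕ.* size x)
    SPACE-≤ x = sup-≤ {fromℕ (5 ℕ.* size x)} (λ (_ , c , _) → fromℕ (space c))
      λ (_ , c , reach) → fromℕ-mono {space c} {5 ℕ.* size x} (visited-space x (visited x reach))

    module _ {𝒯 : Set} (tk : Tokenizer σ 𝒯) where
      open Tokenizer tk

      tokens : Str σ × Str σ → ℕ
      tokens (q , r) = length (τ q) ℕ.+ length (τ r)

      -- The summand 0 is the empty remainder of the sum over the single logged call.
      𝔼tok-≤ : ∀ x → 𝔼tok tk x ≤ fromℕ (tokens (x , y x) ℕ.+ 0)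
      𝔼tok-≤ x = Expectation.𝔼run-≤ lookupAOTM x {fromℕ (tokens (x , y x) ℕ.+ 0)}
        (λ c → fromℕ (sum (map tokens (calls c)))) (0≤fromℕ (tokens (x , y x) ℕ.+ 0))
        λ {_} {c} reach → fromℕ-mono {sum (map tokens (calls c))} {tokens (x , y x) ℕ.+ 0}
          (visited-calls x tokens (visited x reach))

    lookup-for : (T : Task σ) → (∀ {x} → Task.X T x → Task.Y T (y x)) → lookupAOTM For T
    lookup-for T y∈Y = record
      { halts = λ {x} _ →
          Expectation.𝔼run-≤ lookupAOTM x {1∞} (onHalt λ _ → 1∞) 0≤1
            (λ {_} {c} _ → onHalt1≤1 c) ,
          ≤-output (λ _ → 1∞) x
      ; output-Y = λ {x} Xx reach isHalt →
          subst (Task.Y T) (sym (visited-result x (visited x reach) isHalt)) (y∈Y Xx)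
      }
      where
      0≤1 : 0∞ ≤ 1∞
      0≤1 = fromℚ-mono (ℚ.nonNegative⁻¹ 1ℚ)
      onHalt1≤1 : ∀ c → onHalt (λ _ → 1∞) c ≤ 1∞
      onHalt1≤1 c with does (isHalted c)
      ... | true  = ≤-refl {1∞}
      ... | false = 0≤1

  -- The oracle has to answer every string, so inputs outside `X` get the empty string by default.
  total-good-output : ∀ {σ} {𝓜 : AOTM σ} {T : Task σ} → 𝓜 For T → ∀ x →
    ∃[ y ] (Task.X T x → Task.Y T y ×
            Semantics.𝔼output 𝓜 x (λ y → ext (Task.score T x y)) ≤ ext (Task.score T x y))
  total-good-output {T = T} 𝓜-for-T x with em {Task.X T x}
  ... | yes Xx = let y , good = good-output 𝓜-for-T Xx in y , λ _ → good
  ... | no ¬Xx = [] , λ Xx → contradiction Xx ¬Xx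

-- Non-emptiness of the frontier

theorem6p1 : ExcludedMiddle 0ℓ →
    ∀ {σ : ℕ} {𝒯 : Set} (tk : Tokenizer σ 𝒯) (T : Task σ)
    (Xₙ : List (Str σ)) → Unique Xₙ → All (Task.X T) Xₙ →
    (θ : ℝ) → 0∞ < ext θ → ext θ ≤ 1∞ →
    (∃[ 𝓜 ] (𝓜 For T × ext θ ≤ quality T Xₙ 𝓜)) →
    Satisfiable (Frontier tk T θ Xₙ)
theorem6p1 em {σ} tk T Xₙ _ Xₙ⊆X θ _ _ (𝓜 , 𝓜-for-T , θ≤quality) =
  let k , tok≤k = bounded⇒≤real {𝔼∣ 𝒟 Xₙ (Semantics.𝔼tok 𝓛 tk)}
        (𝔼∣-bounded Xₙ (Semantics.𝔼tok 𝓛 tk) (λ x → tokens y tk (x , y x) ℕ.+ 0) (𝔼tok-≤ y tk) 𝒟)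
      t , time≤t = bounded⇒≤real {𝔼∣ 𝒟 Xₙ (Semantics.𝔼TIME 𝓛)}
        (𝔼∣-bounded Xₙ (Semantics.𝔼TIME 𝓛) (Lookup.size y) (𝔼TIME-≤ y) 𝒟)
      s , space≤s = bounded⇒≤real {maxOver Xₙ (Semantics.SPACE 𝓛)}
        (maxOver-bounded Xₙ (Semantics.SPACE 𝓛) (λ x → 5 ℕ.* Lookup.size y x) (SPACE-≤ y))
  in (k , t , s) , 𝓛 , lookup-for y T (λ {x} Xx → proj₁ (proj₂ (outputs x) Xx)) ,
     tok≤k , time≤t , space≤s ,
     ≤-trans {ext θ} {quality T Xₙ 𝓜} {quality T Xₙ 𝓛} θ≤quality
       -- The conditional weights do not depend on the machine, so the qualities are compared input
       -- by input through the score of `y x`.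
       (∑-mono {f = λ x → weight x · 𝔼score 𝓜 x} {λ x → weight x · 𝔼score 𝓛 x}
         (All.map (λ {x} Xx → ·-monoʳ {weight x} {𝔼score 𝓜 x} {𝔼score 𝓛 x} λ _ →
           ≤-trans {𝔼score 𝓜 x} {ext (score x (y x))} {𝔼score 𝓛 x}
             (proj₂ (proj₂ (outputs x) Xx)) (Lookup.≤-output y (λ z → ext (score x z)) x))
           Xₙ⊆X))
  where
  open Task T using (𝒟; score)
  open Classical em
  outputs = total-good-output 𝓜-for-T
  y : Str σ → Str σ
  y x = proj₁ (outputs x)
  𝓛 : AOTM σ
  𝓛 = Lookup.lookupAOTM y
  weight : Str σ → ℝ∞
  weight x = Pr 𝒟 x ÷ ∑ Xₙ (Pr 𝒟)
  𝔼score : AOTM σ → Str σ → ℝ∞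
  𝔼score 𝓜 x = Semantics.𝔼output 𝓜 x λ z → ext (score x z)
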